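{- Let $\gamma>0$ and let $\mathcal{F}$ be the family of (finite simple) graphs whose adjacency matrix has $\gamma_2$-norm at most $\gamma$. Then $\mathcal{F}$ is degree-bounded, that is, for every positive integer $t$ there exists a constant $K=K(\gamma,t)$ such that every graph in $\mathcal{F}$ that contains no $K_{t,t}$ as a subgraph has average degree at most $K$.
   Context: For a real matrix $M$, $\gamma_2(M)=\min_{UV=M}\|U\|_{\mathrm{row}}\|V\|_{\mathrm{col}}$, where the minimum is over all factorizations $M=UV$ into real matrices, $\|U\|_{\mathrm{row}}$ is the maximum $\ell_2$-norm of a row of $U$, and $\|V\|_{\mathrm{col}}$ is the maximum $\ell_2$-norm of a column of $V$. $K_{t,t}$ is the complete bipartite graph with both classes of size $t$. -}

module Defs where

open import Data.Bool.Base using (Bool; true; false; T; _xor_; if_then_else_)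
open import Data.Bool.Properties using (xor-comm; xor-same)
open import Data.Fin.Base using (Fin; splitAt)
open import Data.Fin.Subset using (Subset) renaming (∣_∣ to card)
import Data.Integer.Base as ℤ
import Data.Integer.Properties as ℤₚ
import Data.Nat.Base as ℕ
import Data.Nat.Properties as ℕₚ
open import Data.Nat.Base using (ℕ; zero; suc)
open import Data.Nat.Coprimality using (1-coprimeTo)
open import Data.Product.Base using (Σ; ∃-syntax; _×_; _,_)
open import Data.Rational.Base
open import Data.Rational.Properties
open import Data.Rational.Solver using (module +-*-Solver)
import Data.Rational.Unnormalised.Base as ℚᵘ
import Data.Rational.Unnormalised.Properties as ℚᵘₚ
open import Data.Sum.Base using (inj₁; inj₂; [_,_]′)
import Data.Vec.Base as Vec
open import Data.Vec.Functional using (Vector; foldr; map; transpose)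
open import Function.Definitions using (Injective)
open import Relation.Binary.PropositionalEquality
open import Relation.Nullary using (¬_; Dec; yes; no; does)

private
  variable
    a b c d ε δ : ℚ

  module S = +-*-Solver
  open S using (solve; _:=_; _:+_; _:*_; :-_; _:-_; con)

  half+half : ∀ ε → ½ * ε + ½ * ε ≡ ε
  half+half = solve 1 (λ e → con ½ :* e :+ con ½ :* e := e) refl

  *-pos : 0ℚ < a → 0ℚ < b → 0ℚ < a * b
  *-pos {a} {b} 0<a 0<b =
    subst (_< a * b) (*-zeroʳ a) (*-monoʳ-<-pos a {{positive 0<a}} 0<b)

  *-nonNeg : 0ℚ ≤ a → 0ℚ ≤ b → 0ℚ ≤ a * b
  *-nonNeg {a} {b} 0≤a 0≤b =
    subst (_≤ a * b) (*-zeroʳ a) (*-monoˡ-≤-nonNeg a {{nonNegative 0≤a}} 0≤b)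

  *-mono-≤⁺ : 0ℚ ≤ b → 0ℚ ≤ c → a ≤ b → c ≤ d → a * c ≤ b * d
  *-mono-≤⁺ {b} {c} 0≤b 0≤c a≤b c≤d = ≤-trans
    (*-monoʳ-≤-nonNeg c {{nonNegative 0≤c}} a≤b)
    (*-monoˡ-≤-nonNeg b {{nonNegative 0≤b}} c≤d)

  half-pos : 0ℚ < ε → 0ℚ < ½ * ε
  half-pos = *-pos (positive⁻¹ ½)

  +-pos : 0ℚ < a → 0ℚ < b → 0ℚ < a + b
  +-pos = +-mono-<

  +-nonNeg : 0ℚ ≤ a → 0ℚ ≤ b → 0ℚ ≤ a + b
  +-nonNeg = +-mono-≤

  a≤a+b : 0ℚ ≤ b → a ≤ a + b
  a≤a+b {b} {a} 0≤b = subst (_≤ a + b) (+-identityʳ a) (+-monoʳ-≤ a 0≤b)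

  a≤b+a : 0ℚ ≤ b → a ≤ b + a
  a≤b+a {b} {a} 0≤b = subst (_≤ b + a) (+-identityˡ a) (+-monoˡ-≤ a 0≤b)

  a<a+b : 0ℚ < b → a < a + b
  a<a+b {b} {a} 0<b = subst (_< a + b) (+-identityʳ a) (+-monoʳ-< a 0<b)

  a≤∣a∣ : ∀ a → a ≤ ∣ a ∣
  a≤∣a∣ a with ≤-total 0ℚ a
  ... | inj₁ 0≤a = ≤-reflexive (sym (0≤p⇒∣p∣≡p 0≤a))
  ... | inj₂ a≤0 = ≤-trans a≤0 (0≤∣p∣ a)

  ∣-∣-sym : ∀ a b → ∣ a - b ∣ ≡ ∣ b - a ∣
  ∣-∣-sym a b = trans (sym (∣-p∣≡∣p∣ (a - b)))
    (cong ∣_∣ (solve 2 (λ x y → :- (x :- y) := y :- x) refl a b))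

  close⇒< : ∀ a b → ∣ a - b ∣ < ε → a < b + ε
  close⇒< {ε} a b h = subst (_< b + ε)
    (solve 2 (λ x y → y :+ (x :- y) := x) refl a b)
    (+-monoʳ-< b (≤-<-trans (a≤∣a∣ (a - b)) h))

  <⇒diff< : a < b + ε → a - b < ε
  <⇒diff< {a} {b} {ε} h = subst (a - b <_)
    (solve 2 (λ y e → (y :+ e) :- y := e) refl b ε) (+-monoˡ-< (- b) h)

  <⇒close : a < b + ε → b < a + ε → ∣ a - b ∣ < ε
  <⇒close {a} {b} {ε} p q with ∣p∣≡p∨∣p∣≡-p (a - b)
  ... | inj₁ e = subst (_< ε) (sym e) (<⇒diff< p)
  ... | inj₂ e = subst (_< ε)
    (trans (solve 2 (λ x y → y :- x := :- (x :- y)) refl a b) (sym e)) (<⇒diff< q)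

  +-close : ∀ a b c d → ∣ a - c ∣ < δ → ∣ b - d ∣ < ε → ∣ (a + b) - (c + d) ∣ < δ + ε
  +-close a b c d p q = ≤-<-trans
    (subst (λ z → ∣ z ∣ ≤ ∣ a - c ∣ + ∣ b - d ∣)
      (solve 4 (λ a b c d → (a :- c) :+ (b :- d) := (a :+ b) :- (c :+ d)) refl a b c d)
      (∣p+q∣≤∣p∣+∣q∣ (a - c) (b - d)))
    (+-mono-< p q)

  *-close : ∀ {M} a b c d → 0ℚ < M → ∣ a ∣ ≤ M → ∣ d ∣ ≤ M →
            ∣ a - c ∣ < ε → ∣ b - d ∣ < ε → ∣ a * b - c * d ∣ < M * ε + M * ε
  *-close {ε} {M} a b c d 0<M a≤M d≤M p q = begin-strict
    ∣ a * b - c * d ∣                       ≡⟨ cong ∣_∣ (solve 4 (λ a b c d →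
                                               a :* b :- c :* d := a :* (b :- d) :+ (a :- c) :* d)
                                               refl a b c d) ⟩
    ∣ a * (b - d) + (a - c) * d ∣           ≤⟨ ∣p+q∣≤∣p∣+∣q∣ (a * (b - d)) ((a - c) * d) ⟩
    ∣ a * (b - d) ∣ + ∣ (a - c) * d ∣       ≡⟨ cong₂ _+_ (∣p*q∣≡∣p∣*∣q∣ a (b - d))
                                               (trans (∣p*q∣≡∣p∣*∣q∣ (a - c) d)
                                                 (*-comm ∣ a - c ∣ ∣ d ∣)) ⟩
    ∣ a ∣ * ∣ b - d ∣ + ∣ d ∣ * ∣ a - c ∣   ≤⟨ +-mono-≤
                                               (*-monoʳ-≤-nonNeg ∣ b - d ∣ {{∣-∣-nonNeg (b - d)}} a≤M)
                                               (*-monoʳ-≤-nonNeg ∣ a - c ∣ {{∣-∣-nonNeg (a - c)}} d≤M) ⟩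
    M * ∣ b - d ∣ + M * ∣ a - c ∣           <⟨ +-mono-<
                                               (*-monoʳ-<-pos M {{positive 0<M}} q)
                                               (*-monoʳ-<-pos M {{positive 0<M}} p) ⟩
    M * ε + M * ε                           ∎
    where open ≤-Reasoning

  ⊔-lub-< : ∀ a b c d → a < c + ε → b < d + ε → a ⊔ b < c ⊔ d + ε
  ⊔-lub-< {ε} a b c d p q with ⊔-sel a b
  ... | inj₁ e = subst (_< c ⊔ d + ε) (sym e) (<-≤-trans p (+-monoˡ-≤ ε (p≤p⊔q c d)))
  ... | inj₂ e = subst (_< c ⊔ d + ε) (sym e) (<-≤-trans q (+-monoˡ-≤ ε (p≤q⊔p c d)))

  ⊔-close : ∀ a b c d → ∣ a - c ∣ < ε → ∣ b - d ∣ < ε → ∣ (a ⊔ b) - (c ⊔ d) ∣ < ε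
  ⊔-close {ε} a b c d p q = <⇒close
    (⊔-lub-< a b c d (close⇒< a c p) (close⇒< b d q))
    (⊔-lub-< c d a b (close⇒< c a (subst (_< ε) (∣-∣-sym a c) p))
                     (close⇒< d b (subst (_< ε) (∣-∣-sym b d) q)))

  square-cancel-< : 0ℚ ≤ b → a * a < b * b → a < b
  square-cancel-< {b} {a} 0≤b a²<b² = ≰⇒> λ b≤a →
    <-irrefl refl (<-≤-trans a²<b² (*-mono-≤⁺ (≤-trans 0≤b b≤a) 0≤b b≤a b≤a))

  -- ε / (M + M)
  split : ∀ M → 0ℚ < M → 0ℚ < ε → ∃[ η ] 0ℚ < η × M * η + M * η ≡ ε
  split {ε} M 0<M 0<ε = ½ * ε * r , *-pos (half-pos 0<ε) 0<r , eq
    where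
    instance
      M-pos : Positive M
      M-pos = positive 0<M
      M≢0 : NonZero M
      M≢0 = pos⇒nonZero M
    r = 1/ M
    0<r : 0ℚ < r
    0<r = positive⁻¹ r {{1/pos⇒pos M}}
    eq : M * (½ * ε * r) + M * (½ * ε * r) ≡ ε
    eq = begin
      M * (½ * ε * r) + M * (½ * ε * r)  ≡⟨ solve 3 (λ m e r →
                                             m :* (con ½ :* e :* r) :+ m :* (con ½ :* e :* r)
                                             := (m :* r) :* e) refl M ε r ⟩
      (M * r) * ε                        ≡⟨ cong (_* ε) (*-inverseʳ M) ⟩
      1ℚ * ε                             ≡⟨ *-identityˡ ε ⟩
      ε                                  ∎
      where open ≡-Reasoning

Eventually : (ℕ → Set) → Set
Eventually P = ∃[ N ] ∀ n → N ℕ.≤ n → P n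

IsCauchy : (ℕ → ℚ) → Set
IsCauchy x = ∀ ε → 0ℚ < ε →
  ∃[ N ] ∀ m n → N ℕ.≤ m → N ℕ.≤ n → ∣ x m - x n ∣ < ε

record ℝ : Set where
  no-eta-equality
  constructor mkℝ
  field
    seq    : ℕ → ℚ
    cauchy : IsCauchy seq

open ℝ public

infix 4 _≃ℝ_ _≤ℝ_ _<ℝ_

_≃ℝ_ : ℝ → ℝ → Set
x ≃ℝ y = ∀ ε → 0ℚ < ε → Eventually λ n → ∣ seq x n - seq y n ∣ < ε

_≤ℝ_ : ℝ → ℝ → Set
x ≤ℝ y = ∀ ε → 0ℚ < ε → Eventually λ n → seq x n < seq y n + ε

_<ℝ_ : ℝ → ℝ → Set
x <ℝ y = ∃[ ε ] 0ℚ < ε × Eventually λ n → seq x n + ε < seq y n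

abstract
  const-cauchy : ∀ q → IsCauchy λ _ → q
  const-cauchy q ε 0<ε = 0 , λ _ _ _ _ →
    subst (λ z → ∣ z ∣ < ε) (sym (+-inverseʳ q)) 0<ε

fromℚ : ℚ → ℝ
fromℚ q = mkℝ (λ _ → q) (const-cauchy q)

0ℝ 1ℝ : ℝ
0ℝ = fromℚ 0ℚ
1ℝ = fromℚ 1ℚ

infixl 6 _+ℝ_ _⊔ℝ_
infixl 7 _*ℝ_

private
  ⊔≤ˡ : ∀ M N {n} → M ℕ.⊔ N ℕ.≤ n → M ℕ.≤ n
  ⊔≤ˡ M N = ℕₚ.≤-trans (ℕₚ.m≤m⊔n M N)

  ⊔≤ʳ : ∀ M N {n} → M ℕ.⊔ N ℕ.≤ n → N ℕ.≤ n
  ⊔≤ʳ M N = ℕₚ.≤-trans (ℕₚ.m≤n⊔m M N)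

abstract
  +-cauchy : ∀ x y → IsCauchy λ n → seq x n + seq y n
  +-cauchy x y ε 0<ε =
    let M , p = cauchy x (½ * ε) (half-pos 0<ε)
        N , q = cauchy y (½ * ε) (half-pos 0<ε)
    in M ℕ.⊔ N , λ m n N≤m N≤n →
       subst (∣ (seq x m + seq y m) - (seq x n + seq y n) ∣ <_) (half+half ε)
         (+-close (seq x m) (seq y m) (seq x n) (seq y n)
           (p m n (⊔≤ˡ M N N≤m) (⊔≤ˡ M N N≤n)) (q m n (⊔≤ʳ M N N≤m) (⊔≤ʳ M N N≤n)))

_+ℝ_ : ℝ → ℝ → ℝ
x +ℝ y = mkℝ (λ n → seq x n + seq y n) (+-cauchy x y)

abstract
  ⊔-cauchy : ∀ x y → IsCauchy λ n → seq x n ⊔ seq y n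
  ⊔-cauchy x y ε 0<ε =
    let M , p = cauchy x ε 0<ε
        N , q = cauchy y ε 0<ε
    in M ℕ.⊔ N , λ m n N≤m N≤n →
       ⊔-close (seq x m) (seq y m) (seq x n) (seq y n)
         (p m n (⊔≤ˡ M N N≤m) (⊔≤ˡ M N N≤n)) (q m n (⊔≤ʳ M N N≤m) (⊔≤ʳ M N N≤n))

_⊔ℝ_ : ℝ → ℝ → ℝ
x ⊔ℝ y = mkℝ (λ n → seq x n ⊔ seq y n) (⊔-cauchy x y)

private
  bounded : ∀ x → ∃[ M ] 0ℚ < M × Eventually λ n → ∣ seq x n ∣ ≤ M
  bounded x with cauchy x 1ℚ (positive⁻¹ 1ℚ)
  ... | N , p = ∣ xN ∣ + 1ℚ , +-mono-≤-< (0≤∣p∣ xN) (positive⁻¹ 1ℚ) , N , λ n N≤n →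
      let xn = seq x n in
      ≤-trans (subst (λ z → ∣ z ∣ ≤ ∣ xN ∣ + ∣ xn - xN ∣)
                (solve 2 (λ u v → u :+ (v :- u) := v) refl xN xn)
                (∣p+q∣≤∣p∣+∣q∣ xN (xn - xN)))
              (+-monoʳ-≤ ∣ xN ∣ (<⇒≤ (p n N N≤n ℕₚ.≤-refl)))
    where xN = seq x N

abstract
  *-cauchy : ∀ x y → IsCauchy λ n → seq x n * seq y n
  *-cauchy x y ε 0<ε =
    let A , 0<A , K , ∣x∣≤A = bounded x
        B , 0<B , L , ∣y∣≤B = bounded y
        η , 0<η , eq        = split (A + B) (+-pos 0<A 0<B) 0<ε
        M , p               = cauchy x η 0<η
        N , q               = cauchy y η 0<η
    in (K ℕ.⊔ L) ℕ.⊔ (M ℕ.⊔ N) , λ m n h h′ →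
       let u  = ⊔≤ˡ (K ℕ.⊔ L) (M ℕ.⊔ N) h
           v  = ⊔≤ʳ (K ℕ.⊔ L) (M ℕ.⊔ N) h
           u′ = ⊔≤ˡ (K ℕ.⊔ L) (M ℕ.⊔ N) h′
           v′ = ⊔≤ʳ (K ℕ.⊔ L) (M ℕ.⊔ N) h′
       in subst (∣ seq x m * seq y m - seq x n * seq y n ∣ <_) eq
            (*-close (seq x m) (seq y m) (seq x n) (seq y n) (+-pos 0<A 0<B)
              (≤-trans (∣x∣≤A m (⊔≤ˡ K L u)) (a≤a+b {B} {A} (<⇒≤ 0<B)))
              (≤-trans (∣y∣≤B n (⊔≤ʳ K L u′)) (a≤b+a {A} {B} (<⇒≤ 0<A)))
              (p m n (⊔≤ˡ M N v) (⊔≤ˡ M N v′)) (q m n (⊔≤ʳ M N v) (⊔≤ʳ M N v′)))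

_*ℝ_ : ℝ → ℝ → ℝ
x *ℝ y = mkℝ (λ n → seq x n * seq y n) (*-cauchy x y)

½^_ : ℕ → ℚ
½^ zero  = 1ℚ
½^ suc n = ½ * ½^ n

-- n bisections of [0 , 1 + q], keeping the half that contains the root
-- of q.  The result is the left end point of an interval of length
-- ½^ n * (1 + q).
bisect : ℚ → ℕ → ℚ
bisect q zero    = 0ℚ
bisect q (suc n) =
  let mid = bisect q n + ½^ suc n * (1ℚ + q)
  in if does (mid * mid ≤? q) then mid else bisect q n

private
  0<½^ : ∀ n → 0ℚ < ½^ n
  0<½^ zero    = positive⁻¹ 1ℚ
  0<½^ (suc n) = half-pos (0<½^ n)

  0<width : ∀ n → 0ℚ ≤ a → 0ℚ < ½^ n * (1ℚ + a)
  0<width n 0≤a = *-pos (0<½^ n) (+-mono-<-≤ (positive⁻¹ 1ℚ) 0≤a)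

  bisect-spec : ∀ q → 0ℚ ≤ q → ∀ n → let s = bisect q n ; w = ½^ n * (1ℚ + q) in
                0ℚ ≤ s × s * s ≤ q × q < (s + w) * (s + w)
  bisect-spec q 0≤q zero = ≤-refl , 0≤q ,
    subst (q <_)
      (solve 1 (λ q → q :+ (con 1ℚ :+ q :+ q :* q)
        := (con 0ℚ :+ con 1ℚ :* (con 1ℚ :+ q)) :* (con 0ℚ :+ con 1ℚ :* (con 1ℚ :+ q))) refl q)
      (a<a+b {1ℚ + q + q * q} {q} (+-mono-<-≤ (+-mono-<-≤ (positive⁻¹ 1ℚ) 0≤q) (*-nonNeg 0≤q 0≤q)))
  bisect-spec q 0≤q (suc n) = step (mid * mid ≤? q) (bisect-spec q 0≤q n)
    where
    s = bisect q n
    w = ½^ n * (1ℚ + q)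
    w′ = ½^ suc n * (1ℚ + q)
    mid = s + w′
    step : (d : Dec (mid * mid ≤ q)) → 0ℚ ≤ s × s * s ≤ q × q < (s + w) * (s + w) →
           let s′ = if does d then mid else s in
           0ℚ ≤ s′ × s′ * s′ ≤ q × q < (s′ + w′) * (s′ + w′)
    step (yes mid²≤q) (0≤s , s²≤q , q<) =
      +-nonNeg {s} {w′} 0≤s (<⇒≤ (0<width {q} (suc n) 0≤q)) , mid²≤q ,
      subst (λ z → q < z * z)
        (solve 3 (λ s h q → s :+ h :* (con 1ℚ :+ q)
          := (s :+ (con ½ :* h) :* (con 1ℚ :+ q)) :+ (con ½ :* h) :* (con 1ℚ :+ q))
          refl s (½^ n) q) q<
    step (no mid²≰q) (0≤s , s²≤q , _) = 0≤s , s²≤q , ≰⇒> mid²≰q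

  -- 1 / (n + 1)
  unit : ℕ → ℚ
  unit n = mkℚ (ℤ.+ 1) n (1-coprimeTo (suc n))

  ½unit : ∀ n → ½ * unit n ≤ unit (suc n)
  ½unit n = toℚᵘ-cancel-≤ (ℚᵘₚ.≤-respˡ-≃ (ℚᵘₚ.≃-sym (toℚᵘ-homo-* ½ (unit n)))
    (ℚᵘ.*≤* (ℤ.+≤+ (ℕ.s≤s
      (ℕₚ.≤-trans (ℕₚ.m≤n+m (1 ℕ.* suc n) n) (ℕₚ.m≤m+n (n ℕ.+ 1 ℕ.* suc n) 0))))))

  ½^≤unit : ∀ n → ½^ n ≤ unit n
  ½^≤unit zero    = ≤-refl
  ½^≤unit (suc n) = ≤-trans (*-monoˡ-≤-nonNeg ½ (½^≤unit n)) (½unit n)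

  unit→0 : ∀ ε → 0ℚ < ε → Eventually λ n → unit n < ε
  unit→0 (mkℚ (ℤ.+ suc p) k _) _ = suc k , λ n k<n → *<* (ℤ.+<+ (ℕ.s≤s
    (ℕₚ.≤-trans (subst (ℕ._≤ n) (cong suc (sym (ℕₚ.+-identityʳ k))) k<n)
                (ℕₚ.m≤m+n n (p ℕ.* suc n)))))
  unit→0 (mkℚ (ℤ.+ zero) k _) (*<* (ℤ.+<+ ()))
  unit→0 (mkℚ ℤ.-[1+ p ] k _) (*<* ())

  ½^→0 : ∀ ε → 0ℚ < ε → Eventually λ n → ½^ n < ε
  ½^→0 ε 0<ε =
    let N , p = unit→0 ε 0<ε in N , λ n N≤n → ≤-<-trans (½^≤unit n) (p n N≤n)

  ½^*→0 : ∀ C → 0ℚ < C → ∀ ε → 0ℚ < ε → Eventually λ n → ½^ n * C < ε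
  ½^*→0 C 0<C ε 0<ε =
    let η , 0<η , eq = split C 0<C 0<ε
        N , p        = ½^→0 η 0<η
    in N , λ n N≤n → <-≤-trans
         (*-monoˡ-<-pos C {{positive 0<C}} (p n N≤n))
         (subst (η * C ≤_) eq (subst (_≤ C * η + C * η) (*-comm C η)
           (a≤a+b {C * η} {C * η} (<⇒≤ (*-pos 0<C 0<η)))))

  -- a² ≤ q < r + η² and r < (b + w)² give a < b + 2η.
  root-< : ∀ a b q r w η → 0ℚ ≤ b → 0ℚ < w → w < η → a * a ≤ q → q < r + η * η →
           r < (b + w) * (b + w) → a < b + (η + η)
  root-< a b q r w η 0≤b 0<w w<η a²≤q q<r r<b = square-cancel-<
    (+-nonNeg 0≤b (+-nonNeg 0≤η 0≤η))
    (begin-strict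
      a * a                                            ≤⟨ a²≤q ⟩
      q                                                <⟨ q<r ⟩
      r + η * η                                        <⟨ +-monoˡ-< (η * η) r<b ⟩
      (b + w) * (b + w) + η * η                        ≤⟨ +-monoˡ-≤ (η * η)
                                                          (*-mono-≤⁺ 0≤b+η 0≤b+w b+w≤b+η b+w≤b+η) ⟩
      (b + η) * (b + η) + η * η                        ≤⟨ a≤a+b {η * (b + η) + η * (b + η)}
                                                          (+-nonNeg (*-nonNeg 0≤η 0≤b+η) (*-nonNeg 0≤η 0≤b+η)) ⟩
      ((b + η) * (b + η) + η * η)
        + (η * (b + η) + η * (b + η))                  ≡⟨ solve 2 (λ b e →
                                                          ((b :+ e) :* (b :+ e) :+ e :* e)
                                                            :+ (e :* (b :+ e) :+ e :* (b :+ e))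
                                                          := (b :+ (e :+ e)) :* (b :+ (e :+ e))) refl b η ⟩
      (b + (η + η)) * (b + (η + η))                    ∎)
    where
    open ≤-Reasoning
    0≤η = <⇒≤ (<-trans 0<w w<η)
    0≤b+η = +-nonNeg 0≤b 0≤η
    0≤b+w = +-nonNeg 0≤b (<⇒≤ 0<w)
    b+w≤b+η = +-monoʳ-≤ b (<⇒≤ w<η)

  width-bound : ∀ x → ∃[ C ] 0ℚ < C × Eventually λ n → 1ℚ + (seq x n ⊔ 0ℚ) ≤ C
  width-bound x =
    let M , 0<M , N , ∣x∣≤M = bounded x
    in 1ℚ + M , +-pos (positive⁻¹ 1ℚ) 0<M , N , λ n N≤n →
       +-monoʳ-≤ 1ℚ (⊔-lub (≤-trans (a≤∣a∣ (seq x n)) (∣x∣≤M n N≤n)) (<⇒≤ 0<M))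

abstract
  √-cauchy : ∀ x → IsCauchy λ n → bisect (seq x n ⊔ 0ℚ) n
  √-cauchy x ε 0<ε =
    let η = ½ * ε
        0<η = half-pos 0<ε
        C , 0<C , K , 1+q≤C = width-bound x
        L , ½^C<η = ½^*→0 C 0<C η 0<η
        N , p = cauchy x (η * η) (*-pos 0<η 0<η)
        B = K ℕ.⊔ L ℕ.⊔ N
        w<η : ∀ n → B ℕ.≤ n → w n < η
        w<η n h = ≤-<-trans
          (*-monoˡ-≤-nonNeg (½^ n) {{nonNegative (<⇒≤ (0<½^ n))}}
            (1+q≤C n (⊔≤ˡ K L (⊔≤ˡ (K ℕ.⊔ L) N h))))
          (½^C<η n (⊔≤ʳ K L (⊔≤ˡ (K ℕ.⊔ L) N h)))
        half : ∀ m n → B ℕ.≤ m → B ℕ.≤ n → s m < s n + ε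
        half m n h h′ =
          let _    , s²≤q , _  = bisect-spec (q m) (0≤q m) m
              0≤sn , _    , q< = bisect-spec (q n) (0≤q n) n
          in subst (λ e → s m < s n + e) (half+half ε)
               (root-< (s m) (s n) (q m) (q n) (w n) η 0≤sn (0<width n (0≤q n)) (w<η n h′) s²≤q
                 (⊔-lub-< (seq x m) 0ℚ (seq x n) 0ℚ
                   (close⇒< (seq x m) (seq x n)
                     (p m n (⊔≤ʳ (K ℕ.⊔ L) N h) (⊔≤ʳ (K ℕ.⊔ L) N h′)))
                   (+-pos-0 (*-pos 0<η 0<η)))
                 q<)
    in B , λ m n h h′ → <⇒close (half m n h h′) (half n m h′ h)
    where
    q s w : ℕ → ℚ
    q n = seq x n ⊔ 0ℚ
    s n = bisect (q n) n
    w n = ½^ n * (1ℚ + q n)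

    0≤q : ∀ n → 0ℚ ≤ q n
    0≤q n = p≤q⊔p (seq x n) 0ℚ

    +-pos-0 : ∀ {a} → 0ℚ < a → 0ℚ < 0ℚ + a
    +-pos-0 {a} = subst (0ℚ <_) (sym (+-identityˡ a))

-- √ x is the square root of max x 0.
√ : ℝ → ℝ
√ x = mkℝ (λ n → bisect (seq x n ⊔ 0ℚ) n) (√-cauchy x)

√-nonNeg : ∀ x → 0ℝ ≤ℝ √ x
√-nonNeg x ε 0<ε = 0 , λ n _ →
  let 0≤s , _ = bisect-spec (seq x n ⊔ 0ℚ) (p≤q⊔p (seq x n) 0ℚ) n
  in +-mono-≤-< 0≤s 0<ε

private
  ⊔-< : ∀ {c} a b → a < c → b < c → a ⊔ b < c
  ⊔-< {c} a b p q with ⊔-sel a b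
  ... | inj₁ e = subst (_< c) (sym e) p
  ... | inj₂ e = subst (_< c) (sym e) q

  ½^≤1 : ∀ n → ½^ n ≤ 1ℚ
  ½^≤1 zero    = ≤-refl
  ½^≤1 (suc n) = ≤-trans (*-monoˡ-≤-nonNeg ½ (½^≤1 n)) (*≤* (ℤ.+≤+ (ℕ.s≤s ℕ.z≤n)))

  root-error : ∀ {ε} s q h C → 0ℚ ≤ s → 0ℚ ≤ q → 0ℚ ≤ h → h ≤ 1ℚ → 0ℚ < C → s * s ≤ q → 1ℚ + q ≤ C →
          h * ((C + C + C) * C) < ε →
          (s + h * (1ℚ + q)) * (s + h * (1ℚ + q)) < s * s + ε
  root-error {ε} s q h C 0≤s 0≤q 0≤h h≤1 0<C s²≤q 1+q≤C hC<ε = begin-strict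
    (s + w) * (s + w)                 ≡⟨ solve 2 (λ s w → (s :+ w) :* (s :+ w)
                                         := s :* s :+ (s :+ s :+ w) :* w) refl s w ⟩
    s * s + (s + s + w) * w           ≤⟨ +-monoʳ-≤ (s * s) (*-mono-≤⁺ 0≤3C 0≤w
                                         (+-mono-≤ (+-mono-≤ s≤C s≤C) w≤C) w≤hC) ⟩
    s * s + (C + C + C) * (h * C)     ≡⟨ cong (s * s +_) (solve 2 (λ h c →
                                         (c :+ c :+ c) :* (h :* c)
                                         := h :* ((c :+ c :+ c) :* c)) refl h C) ⟩
    s * s + h * ((C + C + C) * C)     <⟨ +-monoʳ-< (s * s) hC<ε ⟩
    s * s + ε                         ∎
    where
    open ≤-Reasoning
    w = h * (1ℚ + q)
    0≤C = <⇒≤ 0<C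
    0≤3C = +-nonNeg (+-nonNeg 0≤C 0≤C) 0≤C
    0≤1+q = +-nonNeg (<⇒≤ (positive⁻¹ 1ℚ)) 0≤q
    0≤w = *-nonNeg 0≤h 0≤1+q
    w≤hC : w ≤ h * C
    w≤hC = *-monoˡ-≤-nonNeg h {{nonNegative 0≤h}} 1+q≤C
    w≤C : w ≤ C
    w≤C = ≤-trans w≤hC (subst (h * C ≤_) (*-identityˡ C)
      (*-monoʳ-≤-nonNeg C {{nonNegative 0≤C}} h≤1))
    s≤C : s ≤ C
    s≤C = ≤-trans (<⇒≤ (square-cancel-< 0≤1+q (≤-<-trans s²≤q
      (subst (q <_) (solve 1 (λ q → q :+ (con 1ℚ :+ q :+ q :* q)
                              := (con 1ℚ :+ q) :* (con 1ℚ :+ q)) refl q)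
        (a<a+b {1ℚ + q + q * q} {q} (+-mono-<-≤ (+-mono-<-≤ (positive⁻¹ 1ℚ) 0≤q) (*-nonNeg 0≤q 0≤q))))))) 1+q≤C

  √-close : ∀ ε x s h C → let q = x ⊔ 0ℚ ; w = h * (1ℚ + q) in
            0ℚ < ε → 0ℚ < x + ε → 0ℚ ≤ h → h ≤ 1ℚ → 0ℚ < C → 1ℚ + q ≤ C →
            h * ((C + C + C) * C) < ε →
            0ℚ ≤ s × s * s ≤ q × q < (s + w) * (s + w) → ∣ s * s - x ∣ < ε
  √-close ε x s h C 0<ε 0<x+ε 0≤h h≤1 0<C 1+q≤C hC<ε (0≤s , s²≤q , q<) = <⇒close
    (≤-<-trans s²≤q (⊔-< x 0ℚ (a<a+b {ε} {x} 0<ε) 0<x+ε))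
    (≤-<-trans (p≤p⊔q x 0ℚ) (<-trans q<
      (root-error s (x ⊔ 0ℚ) h C 0≤s (p≤q⊔p x 0ℚ) 0≤h h≤1 0<C s²≤q 1+q≤C hC<ε)))

√-square : ∀ x → 0ℝ ≤ℝ x → √ x *ℝ √ x ≃ℝ x
√-square x 0≤x ε 0<ε =
  let C , 0<C , K , 1+q≤C = width-bound x
      L , ½^<ε = ½^*→0 ((C + C + C) * C)
                   (*-pos {C + C + C} {C} (+-pos {C + C} {C} (+-pos {C} {C} 0<C 0<C) 0<C) 0<C) ε 0<ε
      N , 0<x+ε = 0≤x ε 0<ε
  in K ℕ.⊔ L ℕ.⊔ N , λ n h →
     √-close ε (seq x n) (bisect (seq x n ⊔ 0ℚ) n) (½^ n) C 0<ε
       (0<x+ε n (⊔≤ʳ (K ℕ.⊔ L) N h)) (<⇒≤ (0<½^ n)) (½^≤1 n) 0<C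
       (1+q≤C n (⊔≤ˡ K L (⊔≤ˡ (K ℕ.⊔ L) N h)))
       (½^<ε n (⊔≤ʳ K L (⊔≤ˡ (K ℕ.⊔ L) N h)))
       (bisect-spec (seq x n ⊔ 0ℚ) (p≤q⊔p (seq x n) 0ℚ) n)

∑ : ∀ {n} → Vector ℝ n → ℝ
∑ = foldr _+ℝ_ 0ℝ

-- The maximum of a vector of nonnegative reals; 0 for the empty vector.
max⁺ : ∀ {n} → Vector ℝ n → ℝ
max⁺ = foldr _⊔ℝ_ 0ℝ

Matrix : ℕ → ℕ → Set
Matrix m n = Vector (Vector ℝ n) m

infixl 7 _⊗_
infix  4 _≋_

_⊗_ : ∀ {m k n} → Matrix m k → Matrix k n → Matrix m n
(U ⊗ V) i j = ∑ λ l → U i l *ℝ V l j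

_≋_ : ∀ {m n} → Matrix m n → Matrix m n → Set
M ≋ N = ∀ i j → M i j ≃ℝ N i j

‖_‖₂ : ∀ {n} → Vector ℝ n → ℝ
‖ v ‖₂ = √ (∑ λ i → v i *ℝ v i)

‖_‖row : ∀ {m n} → Matrix m n → ℝ
‖ U ‖row = max⁺ (map ‖_‖₂ U)

‖_‖col : ∀ {m n} → Matrix m n → ℝ
‖ V ‖col = ‖ transpose V ‖row

record Factorization {m n} (M : Matrix m n) : Set where
  field
    {inner} : ℕ
    U       : Matrix m inner
    V       : Matrix inner n
    U⊗V≋M   : U ⊗ V ≋ M

  cost : ℝ
  cost = ‖ U ‖row *ℝ ‖ V ‖col

open Factorization public using (cost)

-- γ₂(M) = g: the minimum of the costs is attained and equals g.  This is
-- a relation, since for arbitrary real matrices attainment of the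
-- minimum is not available constructively.
record γ₂[_]≃_ {m n} (M : Matrix m n) (g : ℝ) : Set where
  field
    attained : ∃[ F ] cost {M = M} F ≃ℝ g
    minimal  : ∀ (F : Factorization M) → g ≤ℝ cost F

record Graph (n : ℕ) : Set where
  field
    adj    : Fin n → Fin n → Bool
    symm   : ∀ u v → adj u v ≡ adj v u
    irrefl : ∀ v → adj v v ≡ false

open Graph public

adjacencyMatrix : ∀ {n} → Graph n → Matrix n n
adjacencyMatrix G u v = if adj G u v then 1ℝ else 0ℝ

neighbours : ∀ {n} → Graph n → Fin n → Subset n
neighbours G v = Vec.tabulate (adj G v)

degree : ∀ {n} → Graph n → Fin n → ℕ
degree G v = card (neighbours G v)

-- The graph without vertices has average degree 0.
averageDegree : ∀ {n} → Graph n → ℚ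
averageDegree {zero}      G = 0ℚ
averageDegree {n@(suc _)} G = ℤ.+ foldr ℕ._+_ 0 (degree G) / n

infix 4 _IsSubgraphOf_

-- Not necessarily induced, and up to isomorphism.
_IsSubgraphOf_ : ∀ {m n} → Graph m → Graph n → Set
_IsSubgraphOf_ {m} {n} H G = Σ (Fin m → Fin n) λ f →
  Injective _≡_ _≡_ f × (∀ u v → T (adj H u v) → T (adj G (f u) (f v)))

K⟨_,_⟩ : ∀ s t → Graph (s ℕ.+ t)
K⟨ s , t ⟩ = record
  { adj    = λ u v → inLeft u xor inLeft v
  ; symm   = λ u v → xor-comm (inLeft u) (inLeft v)
  ; irrefl = λ v → xor-same (inLeft v)
  }
  where
  inLeft : Fin (s ℕ.+ t) → Bool
  inLeft u = [ (λ _ → true) , (λ _ → false) ]′ (splitAt s u)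

GraphFamily : Set₁
GraphFamily = ∀ {n} → Graph n → Set

γ₂-AtMost : ℝ → GraphFamily
γ₂-AtMost γ G = ∃[ g ] (γ₂[ adjacencyMatrix G ]≃ g) × (g ≤ℝ γ)

DegreeBounded : GraphFamily → Set
DegreeBounded 𝓕 = ∀ t → 1 ℕ.≤ t → Σ ℝ λ K → ∀ {n} (G : Graph n) → 𝓕 G →
  ¬ (K⟨ t , t ⟩ IsSubgraphOf G) → fromℚ (averageDegree G) ≤ℝ K

{-# OPTIONS --safe #-}

-- Write A = UV with |u_i|² ≤ g and |v_j|² ≤ 1 for the rows of U and the columns of V, restrict A to
-- some rows and columns, and let a_j be the columns, D_j = |a_j|².  With S = ∑ y_j a_j a_jᵀ and
-- w_k = (1 + S)⁻¹ u^k for the columns u^k of U, the operator inequality 2S ≤ (1 + S)² bounds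
-- ∑_{j,k} y_j ⟨a_j , w_k⟩² by ½ ∑ |u_i|², while ∑_k v_kj ⟨a_j , w_k⟩ = ⟨a_j , (1 + S)⁻¹ a_j⟩ is bounded
-- below by positivity of 1 + S.  For y_j = 1 / (κ D_j) this gives ∑ D_j ≤ 2 κ g · #rows as soon as
-- ∑_j ⟨a_j , a_l⟩² ≤ κ D_l² for all l.
--
-- If G has no K_{t,t}, then for every vertex l of large degree D at most M = M(e , t) vertices j have
-- at least D / e common neighbours with l, so ∑_j codeg(j , l)² ≤ (M + Δ / e) D², where Δ bounds the
-- degrees of the rows.  In a smallest vertex set S with more than K |S| edges all degrees are at
-- least K / 2 and at least half of them are at most Δ = 4K; taking these vertices as rows and e a large
-- multiple of g contradicts the previous estimate.
--
-- A real factorization is replaced by its rational approximation at a late index, which is then made exact.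

module Submission where

open import Defs

open import Algebra.Bundles using (CommutativeSemigroup)
open import Algebra.Structures using (IsCommutativeRing; IsCommutativeSemiring)
open import Data.Bool.Base using (Bool; true; false; T; if_then_else_)
open import Data.Bool.Properties using (T?)
open import Data.Empty using (⊥-elim)
open import Data.Fin.Base using (Fin; zero; suc; splitAt; inject≤; _↑ˡ_; _↑ʳ_)
import Data.Fin.Properties as Finₚ
open import Data.Fin.Subset using () renaming (∣_∣ to card)
import Data.Integer.Base as ℤ
import Data.Integer.Properties as ℤₚ
open import Data.List.Base using (List; []; _∷_; _++_; map; length; filter; lookup; allFin; tabulate)
open import Data.List.Membership.Propositional using (_∈_)
open import Data.List.Membership.Propositional.Properties using (∈-∃++; ∈-filter⁻; ∈-lookup)
open import Data.List.Properties using (map-tabulate; length-tabulate)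
open import Data.List.Relation.Binary.Permutation.Propositional using (_↭_; ↭-sym; ↭⇒↭ₛ)
import Data.List.Relation.Binary.Permutation.Propositional as ↭
open import Data.List.Relation.Binary.Permutation.Propositional.Properties using (shift; ∈-resp-↭; ↭-length)
import Data.List.Relation.Binary.Permutation.Setoid.Properties as ↭ₛ
open import Data.List.Relation.Unary.All as All using (All)
open import Data.List.Relation.Unary.AllPairs using (_∷_; [])
open import Data.List.Relation.Unary.Any using (here; there)
open import Data.List.Relation.Unary.Unique.Propositional using (Unique)
import Data.List.Relation.Unary.Unique.Propositional.Properties as Unique
open import Data.Nat.Base as ℕ using (ℕ; zero; suc)
open import Data.Nat.Coprimality using (1-coprimeTo) renaming (sym to coprime-sym)
import Data.Nat.Properties as ℕₚ
open import Data.Product.Base using (∃-syntax; _×_; _,_; proj₁; proj₂)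
import Data.Rational.Unnormalised.Base as ℚᵘ
import Data.Rational.Unnormalised.Properties as ℚᵘₚ
open import Data.Sum.Base using (_⊎_; inj₁; inj₂; [_,_]′)
import Data.Vec.Base as Vec
open import Data.Vec.Functional using (Vector; foldr; transpose)
open import Function.Base using (id)
open import Level using (0ℓ)
open import Relation.Binary.PropositionalEquality hiding (J; [_])
open import Relation.Nullary using (¬_; Dec; yes; no; does; contradiction)
open import Relation.Unary using (Pred; Decidable)

private
  variable
    I J L : Set

-- Finite sums over lists, for natural numbers and for rationals

module ListSum
  {A : Set} {_+_ _*_ : A → A → A} {0# 1# : A}
  (isCommutativeSemiring : IsCommutativeSemiring _≡_ _+_ _*_ 0# 1#)
  (_≼_ : A → A → Set) (≼-refl : ∀ {x} → x ≼ x)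
  (+-mono-≼ : ∀ {w x y z} → w ≼ x → y ≼ z → (w + y) ≼ (x + z))
  where

  open IsCommutativeSemiring isCommutativeSemiring hiding (refl; sym; trans)

  private
    +-commutativeSemigroup : CommutativeSemigroup 0ℓ 0ℓ
    +-commutativeSemigroup = record { isCommutativeSemigroup = +-isCommutativeSemigroup }

  open import Algebra.Properties.CommutativeSemigroup +-commutativeSemigroup using (interchange; x∙yz≈y∙xz)

  private
    variable
      f g : I → A

  sum : List I → (I → A) → A
  sum []       f = 0#
  sum (x ∷ xs) f = f x + sum xs f

  sum-cong : ∀ (xs : List I) → (∀ x → f x ≡ g x) → sum xs f ≡ sum xs g
  sum-cong []       f≗g = refl
  sum-cong (x ∷ xs) f≗g = cong₂ _+_ (f≗g x) (sum-cong xs f≗g)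

  -- The comparison is asked only of members of `xs`, because the degree and correlation bounds
  -- below hold only on the lists that are summed over.
  sum-mono : ∀ (xs : List I) → (∀ {x} → x ∈ xs → f x ≼ g x) → sum xs f ≼ sum xs g
  sum-mono []       f≼g = ≼-refl
  sum-mono (x ∷ xs) f≼g = +-mono-≼ (f≼g (here refl)) (sum-mono xs (λ x∈xs → f≼g (there x∈xs)))

  sum-zero : ∀ (xs : List I) → sum xs (λ _ → 0#) ≡ 0#
  sum-zero []       = refl
  sum-zero (x ∷ xs) = trans (+-identityˡ _) (sum-zero xs)

  sum-+ : ∀ (xs : List I) (f g : I → A) → sum xs (λ x → f x + g x) ≡ sum xs f + sum xs g
  sum-+ []       f g = sym (+-identityˡ 0#)
  sum-+ (x ∷ xs) f g = trans (cong (_ +_) (sum-+ xs f g)) (interchange (f x) (g x) (sum xs f) (sum xs g))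

  sum-*ˡ : ∀ (xs : List I) c (f : I → A) → sum xs (λ x → c * f x) ≡ c * sum xs f
  sum-*ˡ []       c f = sym (zeroʳ c)
  sum-*ˡ (x ∷ xs) c f = trans (cong (_ +_) (sum-*ˡ xs c f)) (sym (distribˡ c _ _))

  sum-*ʳ : ∀ (xs : List I) c (f : I → A) → sum xs (λ x → f x * c) ≡ sum xs f * c
  sum-*ʳ xs c f = trans (sum-cong xs (λ x → *-comm (f x) c)) (trans (sum-*ˡ xs c f) (*-comm c _))

  sum-comm : ∀ (xs : List I) (ys : List J) (f : I → J → A) →
             sum xs (λ x → sum ys (λ y → f x y)) ≡ sum ys (λ y → sum xs (λ x → f x y))
  sum-comm []       ys f = sym (sum-zero ys)
  sum-comm (x ∷ xs) ys f = trans (cong (_ +_) (sum-comm xs ys f))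
    (sym (sum-+ ys (f x) (λ y → sum xs (λ x → f x y))))

  sum-++ : ∀ (xs ys : List I) (f : I → A) → sum (xs ++ ys) f ≡ sum xs f + sum ys f
  sum-++ []       ys f = sym (+-identityˡ _)
  sum-++ (x ∷ xs) ys f = trans (cong (_ +_) (sum-++ xs ys f)) (sym (+-assoc _ _ _))

  sum-map : ∀ (h : I → J) xs (f : J → A) → sum (map h xs) f ≡ sum xs (λ x → f (h x))
  sum-map h []       f = refl
  sum-map h (x ∷ xs) f = cong (f (h x) +_) (sum-map h xs f)

  sum-↭ : ∀ {xs ys : List I} (f : I → A) → xs ↭ ys → sum xs f ≡ sum ys f
  sum-↭ f ↭.refl                   = refl
  sum-↭ f (↭.prep x p)             = cong (_ +_) (sum-↭ f p)
  sum-↭ f (↭.swap {xs} x y p)    = trans (x∙yz≈y∙xz (f x) (f y) (sum xs f))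
    (cong (_ +_) (cong (_ +_) (sum-↭ f p)))
  sum-↭ f (↭.trans p q)            = trans (sum-↭ f p) (sum-↭ f q)

open module Sumℕ = ListSum ℕₚ.+-*-isCommutativeSemiring ℕ._≤_ ℕₚ.≤-refl ℕₚ.+-mono-≤
  using () renaming (sum to ∑ℕ)

-- Counting in graphs

module Counting where

  open import Data.Nat.Base
  open import Data.Nat.Properties
  open import Data.Nat.Solver using (module +-*-Solver)

  χ : Bool → ℕ
  χ b = if b then 1 else 0

  χ-T : ∀ {b} → T b → χ b ≡ 1
  χ-T {true} _ = refl

  χ-idem : ∀ b → χ b * χ b ≡ χ b
  χ-idem true  = refl
  χ-idem false = refl

  ∑-const : ∀ (xs : List I) c → (∑ℕ xs λ _ → c) ≡ length xs * c
  ∑-const []       c = refl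
  ∑-const (x ∷ xs) c = cong (c +_) (∑-const xs c)

  module _ {P : Pred I 0ℓ} (P? : Decidable P) where

    ∑-filter : ∀ xs (f : I → ℕ) → ∑ℕ (filter P? xs) f ≡ ∑ℕ xs λ x → χ (does (P? x)) * f x
    ∑-filter []       f = refl
    ∑-filter (x ∷ xs) f with does (P? x)
    ... | true  = cong₂ _+_ (sym (+-identityʳ (f x))) (∑-filter xs f)
    ... | false = ∑-filter xs f

    length-filter-∑ : ∀ xs → length (filter P? xs) ≡ ∑ℕ xs λ x → χ (does (P? x))
    length-filter-∑ []       = refl
    length-filter-∑ (x ∷ xs) with does (P? x)
    ... | true  = cong suc (length-filter-∑ xs)
    ... | false = length-filter-∑ xs

  averaging : ∀ (x : I) xs (f : I → ℕ) q → length (x ∷ xs) * q ≤ ∑ℕ (x ∷ xs) f →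
              ∃[ y ] y ∈ x ∷ xs × q ≤ f y
  averaging x []       f q h = x , here refl , +-cancelʳ-≤ 0 q (f x) h
  averaging x (y ∷ xs) f q h with q ≤? f x
  ... | yes q≤fx = x , here refl , q≤fx
  ... | no  q≰fx =
    let z , z∈ , q≤fz = averaging y xs f q
          (+-cancelˡ-≤ q _ _ (≤-trans h (+-monoˡ-≤ (∑ℕ (y ∷ xs) f) (<⇒≤ (≰⇒> q≰fx)))))
    in z , there z∈ , q≤fz

  split-∈ : ∀ {x : I} {xs} → Unique xs → x ∈ xs → ∃[ ys ] xs ↭ (x ∷ ys) × Unique (x ∷ ys)
  split-∈ {x = x} u x∈xs with ys , zs , refl ← ∈-∃++ x∈xs =
    ys ++ zs , shift x ys zs , ↭ₛ.Unique-resp-↭ (setoid _) (↭⇒↭ₛ (shift x ys zs)) u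

  lookup-injective : ∀ {xs : List I} → Unique xs → ∀ {i j} → lookup xs i ≡ lookup xs j → i ≡ j
  lookup-injective {xs = x ∷ xs} (x∉ ∷ u) {zero}  {zero}  eq = refl
  lookup-injective {xs = x ∷ xs} (x∉ ∷ u) {zero}  {suc j} eq = ⊥-elim (All.lookup x∉ (∈-lookup j) eq)
  lookup-injective {xs = x ∷ xs} (x∉ ∷ u) {suc i} {zero}  eq = ⊥-elim (All.lookup x∉ (∈-lookup i) (sym eq))
  lookup-injective {xs = x ∷ xs} (x∉ ∷ u) {suc i} {suc j} eq = cong suc (lookup-injective u eq)

  -- All-ones rectangles and complete bipartite subgraphs

  module _ (A : I → J → Bool) where

    colDegree : List I → J → ℕ
    colDegree xs j = ∑ℕ xs λ i → χ (A i j)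

    rowDegree : List J → I → ℕ
    rowDegree ys i = ∑ℕ ys λ j → χ (A i j)

    -- `left` gains one row in each round of `dense⇒rectangle`, whereas `right` results from
    -- repeated filtering and is only bounded from below; `rectangle⇒K` cuts it down with `inject≤`.
    record Rectangle (xs : List I) (ys : List J) (s : ℕ) (m : ℕ) : Set where
      field
        left         : List I
        right        : List J
        left-unique  : Unique left
        right-unique : Unique right
        left-length  : length left ≡ s
        right-length : m ≤ length right
        left⊆        : ∀ {i} → i ∈ left → i ∈ xs
        right⊆       : ∀ {j} → j ∈ right → j ∈ ys
        complete     : ∀ {i j} → i ∈ left → j ∈ right → T (A i j)

    -- If every column of ys has density at least 1/h in xs, even after deleting s rows, then some
    -- row is met by a fraction 1/h of ys; pass to these columns, delete the row, and iterate.
    dense⇒rectangle : ∀ h .{{_ : NonZero h}} s m d xs ys → Unique xs → Unique ys →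
      0 < length ys → length xs ≤ d → (∀ {j} → j ∈ ys → d + h * s ≤ h * colDegree xs j) →
      h ^ s * m ≤ length ys → Rectangle xs ys s m
    dense⇒rectangle h zero m d xs ys uxs uys _ _ _ m≤ = record
      { left = [] ; right = ys ; left-unique = [] ; right-unique = uys ; left-length = refl
      ; right-length = subst (_≤ length ys) (+-identityʳ m) m≤
      ; left⊆ = λ () ; right⊆ = λ j∈ → j∈ ; complete = λ () }
    dense⇒rectangle h (suc s) m d xs ys@(y ∷ _) uxs uys 0<ys xs≤d dense m≤ = record
      { left = i ∷ left ; right = right
      ; left-unique = All.tabulate (λ {k} k∈ → All.lookup i∉ (left⊆ k∈)) ∷ left-unique
      ; right-unique = right-unique ; left-length = cong suc left-length ; right-length = right-length
      ; left⊆ = λ { (here refl) → i∈xs ; (there k∈) → ∈-resp-↭ (↭-sym xs↭) (there (left⊆ k∈)) }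
      ; right⊆ = λ j∈ → proj₁ (∈-filter⁻ (λ j → T? (A i j)) {xs = ys} (right⊆ j∈))
      ; complete = λ { (here refl) j∈ → proj₂ (∈-filter⁻ (λ j → T? (A i j)) {xs = ys} (right⊆ j∈))
                     ; (there k∈) j∈ → complete k∈ j∈ } }
      where
      -- The ones are counted by columns, each holding at least `d / h` of them, and then by rows.
      -- The bound `d` stays fixed during the recursion while the rows become fewer.
      total : length xs * length ys ≤ ∑ℕ xs λ i → h * rowDegree ys i
      total = begin
        length xs * length ys
          ≤⟨ *-monoˡ-≤ (length ys) xs≤d ⟩
        d * length ys
          ≡⟨ trans (*-comm d (length ys)) (sym (∑-const ys d)) ⟩
        ∑ℕ ys (λ _ → d)
          ≤⟨ Sumℕ.sum-mono ys (λ j∈ → ≤-trans (m≤m+n d (h * suc s)) (dense j∈)) ⟩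
        ∑ℕ ys (λ j → h * colDegree xs j)
          ≡⟨ trans (Sumℕ.sum-*ˡ ys h (colDegree xs)) (trans
               (cong (h *_) (Sumℕ.sum-comm ys xs (λ j i → χ (A i j)))) (sym (Sumℕ.sum-*ˡ xs h (rowDegree ys)))) ⟩
        ∑ℕ xs (λ i → h * rowDegree ys i) ∎
        where open ≤-Reasoning

      average : ∀ zs → d + h * suc s ≤ h * colDegree zs y → length zs * length ys ≤ ∑ℕ zs (λ i → h * rowDegree ys i) →
                ∃[ i ] i ∈ zs × length ys ≤ h * rowDegree ys i
      -- Without rows the column `y` would violate the density hypothesis, as `h * suc s` is
      -- positive.
      average []       p _ = contradiction (≤-trans (m≤n+m (h * suc s) d) p)
        (<⇒≱ (subst (_< h * suc s) (sym (*-zeroʳ h)) (≤-trans (>-nonZero⁻¹ h) (m≤m*n h (suc s)))))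
      average (z ∷ zs) _ q = averaging z zs (λ i → h * rowDegree ys i) (length ys) q

      popular : ∃[ i ] i ∈ xs × length ys ≤ h * rowDegree ys i
      popular = average xs (dense (here refl)) total

      i    = proj₁ popular
      i∈xs = proj₁ (proj₂ popular)

      splitting : ∃[ xs′ ] xs ↭ (i ∷ xs′) × Unique (i ∷ xs′)
      splitting = split-∈ uxs i∈xs

      xs′ = proj₁ splitting
      ys′ = filter (λ j → T? (A i j)) ys

      xs↭ : xs ↭ (i ∷ xs′)
      xs↭ = proj₁ (proj₂ splitting)

      i∉ : All (i ≢_) xs′
      i∉ with i∉ ∷ _ ← proj₂ (proj₂ splitting) = i∉

      uxs′ : Unique xs′
      uxs′ with _ ∷ u ← proj₂ (proj₂ splitting) = u

      ys≤ : length ys ≤ h * length ys′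
      ys≤ = subst (λ l → length ys ≤ h * l) (sym (length-filter-∑ (λ j → T? (A i j)) ys)) (proj₂ (proj₂ popular))

      0<ys′ : 0 < length ys′
      0<ys′ = n≢0⇒n>0 λ e → contradiction (≤-trans 0<ys ys≤)
        (subst (λ l → ¬ 1 ≤ h * l) (sym e) (subst (λ l → ¬ 1 ≤ l) (sym (*-zeroʳ h)) λ ()))

      -- The deleted row `i` meets every column of `ys′`, so each column degree drops by exactly
      -- one. This costs `h`, which is one unit of the slack `h * suc s`.
      dense′ : ∀ {j} → j ∈ ys′ → d + h * s ≤ h * colDegree xs′ j
      dense′ {j} j∈ = +-cancelˡ-≤ h _ _ (begin
        h + (d + h * s)                    ≡⟨ +-assoc h d (h * s) ⟨
        h + d + h * s                      ≡⟨ cong (_+ h * s) (+-comm h d) ⟩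
        d + h + h * s                      ≡⟨ trans (+-assoc d h (h * s)) (cong (d +_) (sym (*-suc h s))) ⟩
        d + h * suc s                      ≤⟨ dense j∈ys ⟩
        h * colDegree xs j                 ≡⟨ cong (h *_) (Sumℕ.sum-↭ (λ k → χ (A k j)) xs↭) ⟩
        h * (χ (A i j) + colDegree xs′ j)  ≡⟨ cong (λ c → h * (c + colDegree xs′ j)) (χ-T Aij) ⟩
        h * suc (colDegree xs′ j)          ≡⟨ *-suc h _ ⟩
        h + h * colDegree xs′ j            ∎)
        where
        open ≤-Reasoning
        j∈ys = proj₁ (∈-filter⁻ (λ j → T? (A i j)) {xs = ys} j∈)
        Aij  = proj₂ (∈-filter⁻ (λ j → T? (A i j)) {xs = ys} j∈)

      rectangle : Rectangle xs′ ys′ s m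
      rectangle = dense⇒rectangle h s m d xs′ ys′ uxs′ (Unique.filter⁺ (λ j → T? (A i j)) uys) 0<ys′
        (≤-trans (n≤1+n _) (subst (_≤ d) (↭-length xs↭) xs≤d)) dense′
        (*-cancelˡ-≤ h (≤-trans (subst (_≤ length ys) (*-assoc h (h ^ s) m) m≤) ys≤))

      open Rectangle rectangle

  rectangle⇒K : ∀ {n} (G : Graph n) {xs ys s t} → Rectangle (adj G) xs ys s t → K⟨ s , t ⟩ IsSubgraphOf G
  rectangle⇒K {n} G {s = s} {t} rectangle = f , injective , edges
    where
    open Rectangle rectangle
    x : Fin s → Fin n
    x i = lookup left (subst Fin (sym left-length) i)
    y : Fin t → Fin n
    y j = lookup right (inject≤ j right-length)

    Axy : ∀ i j → T (adj G (x i) (y j))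
    Axy i j = complete (∈-lookup _) (∈-lookup _)

    -- Nothing in `Rectangle` keeps the two sides apart; the absence of loops does.
    x≢y : ∀ i j → x i ≢ y j
    x≢y i j eq = subst T (trans (cong (λ v → adj G v (y j)) eq) (irrefl G (y j))) (Axy i j)

    f : Fin (s + t) → Fin n
    f u = [ x , y ]′ (splitAt s u)

    injective : ∀ {u v} → f u ≡ f v → u ≡ v
    injective {u} {v} eq with splitAt s u in eu | splitAt s v in ev
    ... | inj₁ i | inj₁ j = trans (sym (Finₚ.splitAt⁻¹-↑ˡ eu)) (trans
      (cong (_↑ˡ t) (subst-injective (sym left-length) (lookup-injective left-unique eq)))
      (Finₚ.splitAt⁻¹-↑ˡ ev))
    ... | inj₁ i | inj₂ j = contradiction eq (x≢y i j)
    ... | inj₂ i | inj₁ j = contradiction (sym eq) (x≢y j i)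
    ... | inj₂ i | inj₂ j = trans (sym (Finₚ.splitAt⁻¹-↑ʳ eu)) (trans
      (cong (s ↑ʳ_) (Finₚ.inject≤-injective _ _ _ _ (lookup-injective right-unique eq)))
      (Finₚ.splitAt⁻¹-↑ʳ ev))

    edges : ∀ u v → T (adj K⟨ s , t ⟩ u v) → T (adj G (f u) (f v))
    edges u v h with splitAt s u | splitAt s v
    ... | inj₁ i | inj₂ j = Axy i j
    ... | inj₂ i | inj₁ j = subst T (symm G (x j) (y i)) (Axy j i)

  χ≤1 : ∀ b → χ b ≤ 1
  χ≤1 true  = ≤-refl
  χ≤1 false = z≤n

  χ*≤ : ∀ b m → χ b * m ≤ m
  χ*≤ true  m = ≤-reflexive (+-identityʳ m)
  χ*≤ false m = z≤n

  -- The pointwise form of a truncation. After summation the first term becomes a count or a sum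
  -- over a filtered list, while `z` is paid everywhere.
  χ-cases : ∀ {P : Set} (P? : Dec P) {x y z} → (P → x ≤ y) → (¬ P → x ≤ z) →
            x ≤ χ (does P?) * y + z
  χ-cases (yes p) {y = y} {z} f _ = ≤-trans (≤-trans (f p) (≤-reflexive (sym (+-identityʳ y)))) (m≤m+n _ z)
  χ-cases (no ¬p) _ g = g ¬p

  -- Codegrees and edge counts

  module _ {n} (G : Graph n) where

    open +-*-Solver

    private
      A = adj G

    codegree : List (Fin n) → Fin n → Fin n → ℕ
    codegree rows l j = ∑ℕ rows λ i → χ (A i l) * χ (A i j)

    codegree≤ : ∀ rows l j → codegree rows l j ≤ colDegree A rows l
    codegree≤ rows l j = Sumℕ.sum-mono rows λ {i} _ →
      subst (_≤ χ (A i l)) (*-comm (χ (A i j)) (χ (A i l))) (χ*≤ (A i j) (χ (A i l)))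

    module _ (t : ℕ) (0<t : 0 < t) (K-free : ¬ (K⟨ t , t ⟩ IsSubgraphOf G)) where

      -- With `D` the degree of `l`, call a column heavy if its codegree `c` with `l` is at least
      -- `D / e`. A heavy column contributes at most `e D²`, and fewer than `(2e)^t t` of them
      -- exist, since more would give a rectangle inside the neighbourhood of `l`. For a light
      -- column `e c² ≤ D c`, and the sum of all `c` counts the row degrees over the neighbours of
      -- `l`, at most `D Δ`.
      ∑-codegree² : ∀ e .{{_ : NonZero e}} Δ rows cols l → Unique rows → Unique cols →
        (∀ {i} → i ∈ rows → rowDegree A cols i ≤ Δ) → 2 * e * t ≤ colDegree A rows l →
        e * ∑ℕ cols (λ j → codegree rows l j * codegree rows l j) ≤
          (e * ((2 * e) ^ t * t) + Δ) * (colDegree A rows l * colDegree A rows l)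
      ∑-codegree² e Δ rows cols l urows ucols row≤Δ ht≤D = begin
        e * ∑ℕ cols (λ j → c j * c j)
          ≡⟨ Sumℕ.sum-*ˡ cols e _ ⟨
        ∑ℕ cols (λ j → e * (c j * c j))
          ≤⟨ Sumℕ.sum-mono cols (λ {j} _ → pointwise j) ⟩
        ∑ℕ cols (λ j → χ (does (heavy? j)) * (e * (D * D)) + D * c j)
          ≡⟨ trans (Sumℕ.sum-+ cols _ _) (cong₂ _+_
               (trans (Sumℕ.sum-*ʳ cols (e * (D * D)) _) (cong (_* (e * (D * D))) (sym (length-filter-∑ heavy? cols))))
               (Sumℕ.sum-*ˡ cols D c)) ⟩
        length Q * (e * (D * D)) + D * ∑ℕ cols c
          ≤⟨ +-mono-≤ (*-monoˡ-≤ (e * (D * D)) (<⇒≤ few-heavy)) (*-monoʳ-≤ D ∑c≤) ⟩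
        (h ^ t * t) * (e * (D * D)) + D * (D * Δ)
          ≡⟨ solve 4 (λ m e d Δ → m :* (e :* (d :* d)) :+ d :* (d :* Δ) := (e :* m :+ Δ) :* (d :* d))
               refl (h ^ t * t) e D Δ ⟩
        (e * (h ^ t * t) + Δ) * (D * D) ∎
        where
        open ≤-Reasoning
        h D : ℕ
        h = 2 * e
        D = colDegree A rows l
        c : Fin n → ℕ
        c = codegree rows l
        heavy? : ∀ j → _
        heavy? j = D ≤? e * c j
        P Q : List (Fin n)
        P = filter (λ i → T? (A i l)) rows
        Q = filter heavy? cols
        instance
          h≢0 : NonZero h
          h≢0 = m*n≢0 2 e
          h^t≢0 : NonZero (h ^ t)
          h^t≢0 = m^n≢0 h t

        pointwise : ∀ j → e * (c j * c j) ≤ χ (does (heavy? j)) * (e * (D * D)) + D * c j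
        pointwise j = χ-cases (heavy? j)
          (λ _ → *-monoʳ-≤ e (*-mono-≤ (codegree≤ rows l j) (codegree≤ rows l j)))
          (λ p → subst (_≤ D * c j) (*-assoc e (c j) (c j)) (*-monoˡ-≤ (c j) (<⇒≤ (≰⇒> p))))

        ∑c≤ : ∑ℕ cols c ≤ D * Δ
        ∑c≤ = begin
          ∑ℕ cols c
            ≡⟨ trans (Sumℕ.sum-comm cols rows _) (Sumℕ.sum-cong rows λ i → Sumℕ.sum-*ˡ cols (χ (A i l)) _) ⟩
          ∑ℕ rows (λ i → χ (A i l) * rowDegree A cols i)
            ≤⟨ Sumℕ.sum-mono rows (λ {i} i∈ → *-monoʳ-≤ (χ (A i l)) (row≤Δ i∈)) ⟩
          ∑ℕ rows (λ i → χ (A i l) * Δ)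
            ≡⟨ Sumℕ.sum-*ʳ rows Δ _ ⟩
          D * Δ ∎

        -- Here `h = 2 * e` is used: one copy of `e * c j` covers the number `D` of rows of `P`, the
        -- other covers the slack `h * t`, which is at most `D` by `ht≤D`.
        dense : ∀ {j} → j ∈ Q → D + h * t ≤ h * colDegree A P j
        dense {j} j∈ = begin
          D + h * t            ≤⟨ +-mono-≤ D≤ec (≤-trans ht≤D D≤ec) ⟩
          e * c j + e * c j    ≡⟨ solve 2 (λ e c → e :* c :+ e :* c := con 2 :* e :* c) refl e (c j) ⟩
          h * c j              ≡⟨ cong (h *_) (∑-filter (λ i → T? (A i l)) rows (λ i → χ (A i j))) ⟨
          h * colDegree A P j  ∎
          where
          D≤ec : D ≤ e * c j
          D≤ec = proj₂ (∈-filter⁻ heavy? {xs = cols} j∈)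

        few-heavy : length Q < h ^ t * t
        few-heavy = ≰⇒> λ many → K-free (rectangle⇒K G (dense⇒rectangle A h t t D P Q
          (Unique.filter⁺ (λ i → T? (A i l)) urows) (Unique.filter⁺ heavy? ucols)
          (≤-trans (≤-trans 0<t (m≤n*m t (h ^ t))) many)
          (≤-reflexive (length-filter-∑ (λ i → T? (A i l)) rows)) dense many))

    -- This counts ordered pairs, so it is twice the number of edges induced on a duplicate-free
    -- `S`.
    edges : List (Fin n) → ℕ
    edges S = ∑ℕ S (rowDegree A S)

    -- Deleting `i` removes its row and, by symmetry, an equal column of the adjacency matrix; each
    -- carries at most `rowDegree A S i`.
    edges-delete : ∀ {S S′ i} → S ↭ (i ∷ S′) → edges S ≤ 2 * rowDegree A S i + edges S′
    edges-delete {S} {S′} {i} S↭ = begin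
      edges S
        ≡⟨ trans (Sumℕ.sum-↭ _ S↭) (Sumℕ.sum-cong (i ∷ S′) λ p → Sumℕ.sum-↭ _ S↭) ⟩
      r (i ∷ S′) i + ∑ℕ S′ (λ p → χ (A p i) + r S′ p)
        ≡⟨ cong₂ _+_ (sym (Sumℕ.sum-↭ _ S↭)) (trans (Sumℕ.sum-+ S′ _ _)
             (cong (_+ edges S′) (Sumℕ.sum-cong S′ λ p → cong χ (symm G p i)))) ⟩
      r S i + (r S′ i + edges S′)
        ≤⟨ +-monoʳ-≤ (r S i) (+-monoˡ-≤ (edges S′) (≤-trans (m≤n+m (r S′ i) (χ (A i i)))
             (≤-reflexive (sym (Sumℕ.sum-↭ _ S↭))))) ⟩
      r S i + (r S i + edges S′)
        ≡⟨ solve 2 (λ r e → r :+ (r :+ e) := con 2 :* r :+ e) refl (r S i) (edges S′) ⟩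
      2 * r S i + edges S′ ∎
      where
      open ≤-Reasoning
      r = rowDegree A

    -- The conclusion of the spectral argument, for a bound e ∑ c² ≤ L D² on the codegrees c.
    MassBound : ℕ → Set
    MassBound g = ∀ e .{{_ : NonZero e}} L .{{_ : NonZero L}} rows cols →
      (∀ {j} → j ∈ cols → 0 < colDegree A rows j) →
      (∀ {l} → l ∈ cols → e * ∑ℕ cols (λ j → codegree rows l j * codegree rows l j) ≤
                            L * (colDegree A rows l * colDegree A rows l)) →
      e * ∑ℕ cols (colDegree A rows) ≤ 2 * (L * (length rows * g))

  -- The edge bound, by a smallest dense vertex set

  module _ (g t : ℕ) where

    -- `density` is the `e` of `∑-codegree²` and `light-column` the least degree to which that lemma
    -- applies. The factor 32 lets the term `4 * K` coming from the row degrees absorb only half of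
    -- the main term in `contra`; the first two summands of `edge-bound` are what remains there. The
    -- final 2 makes the contradiction strict and gives `2 ≤ K` for `edges≤`.
    density light-column edge-bound : ℕ
    density      = 32 * g
    light-column = 2 * density * t
    edge-bound   = 8 * (g * ((2 * density) ^ t * t)) + 8 * light-column + 2

  module _ (g t : ℕ) .{{_ : NonZero g}} (0<t : 0 < t) {n} (G : Graph n)
           (K-free : ¬ (K⟨ t , t ⟩ IsSubgraphOf G)) (mass : MassBound G g) where

    open +-*-Solver

    private
      A = adj G
      r = rowDegree A
      e = density g t
      s = light-column g t
      K = edge-bound g t
      M = (2 * e) ^ t * t
      instance
        e≢0 : NonZero e
        e≢0 = m*n≢0 32 g

    -- The induction hypothesis for `S` without one vertex plays the role of minimality of a
    -- counterexample. The contradiction comes from counting the ones in the rows `R` of moderate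
    -- degree: from below through `K≤2r`, from above through the mass bound on the columns `C` that
    -- are not light.
    sparse : ∀ m S → length S ≡ m → Unique S → edges G S ≤ K * m
    sparse zero    []        _  _  = z≤n
    sparse zero    (_ ∷ _)   ()
    sparse (suc m) S         |S| uS = ≮⇒≥ λ dense → <-irrefl refl (contra dense)
      where
      module _ (dense : K * suc m < edges G S) where

        member : ∃[ v ] v ∈ S
        member = nonempty S |S|
          where
          nonempty : ∀ xs → length xs ≡ suc m → ∃[ v ] v ∈ xs
          nonempty (v ∷ _) _ = v , here refl

        v = proj₁ member

        R C : List (Fin n)
        R = filter (λ i → r S i ≤? 4 * K) S
        C = filter (λ j → s ≤? colDegree A R j) S

        uR : Unique R
        uR = Unique.filter⁺ (λ i → r S i ≤? 4 * K) uS

        uC : Unique C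
        uC = Unique.filter⁺ (λ j → s ≤? colDegree A R j) uS

        delete : ∀ {i} → i ∈ S → edges G S ≤ 2 * r S i + K * m
        delete {i} i∈ with split-∈ uS i∈
        ... | S′ , S↭ , _ ∷ uS′ = ≤-trans (edges-delete G S↭)
          (+-monoʳ-≤ (2 * r S i) (sparse m S′ (suc-injective (trans (sym (↭-length S↭)) |S|)) uS′))

        K≤2r : ∀ {i} → i ∈ S → K ≤ 2 * r S i
        K≤2r {i} i∈ = +-cancelʳ-≤ (K * m) K (2 * r S i)
          (subst (_≤ 2 * r S i + K * m) (*-suc K m) (≤-trans (<⇒≤ dense) (delete i∈)))

        -- Minimality also bounds the count from above: deleting the single vertex `v` loses at most
        -- `2 * suc m`, and `2 ≤ K`.
        edges≤ : edges G S ≤ 2 * K * suc m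
        edges≤ = begin
          edges G S              ≤⟨ delete (proj₂ member) ⟩
          2 * r S v + K * m      ≤⟨ +-monoˡ-≤ (K * m) (*-monoʳ-≤ 2 (≤-trans
                                      (Sumℕ.sum-mono S (λ {j} _ → χ≤1 (A v j)))
                                      (≤-reflexive (trans (∑-const S 1) (trans (*-identityʳ (length S)) |S|))))) ⟩
          2 * suc m + K * m      ≤⟨ +-mono-≤ (*-monoˡ-≤ (suc m) (m≤n+m 2 (8 * (g * M) + 8 * s))) (*-monoʳ-≤ K (n≤1+n m)) ⟩
          K * suc m + K * suc m  ≡⟨ solve 2 (λ K m → K :* m :+ K :* m := con 2 :* K :* m) refl K (suc m) ⟩
          2 * K * suc m          ∎
          where open ≤-Reasoning

        instance
          K≢0 : NonZero K
          K≢0 = >-nonZero (≤-trans (s≤s z≤n) (m≤n+m 2 (8 * (g * M) + 8 * s)))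

        -- Markov's inequality: the average degree is at most `2 * K`, so at most half of the
        -- vertices have degree above `4 * K`.
        |S|≤2|R| : suc m ≤ 2 * length R
        |S|≤2|R| = *-cancelˡ-≤ (2 * K) {{m*n≢0 2 K}} (+-cancelʳ-≤ (2 * K * suc m) _ _ (begin
          2 * K * suc m + 2 * K * suc m
            ≡⟨ solve 2 (λ K m → con 2 :* K :* m :+ con 2 :* K :* m := m :* (con 4 :* K)) refl K (suc m) ⟩
          suc m * (4 * K)
            ≡⟨ trans (cong (_* (4 * K)) (sym |S|)) (sym (∑-const S (4 * K))) ⟩
          ∑ℕ S (λ _ → 4 * K)
            ≤⟨ Sumℕ.sum-mono S (λ {i} _ → pointwise i) ⟩
          ∑ℕ S (λ i → χ (does (r S i ≤? 4 * K)) * (4 * K) + r S i)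
            ≡⟨ trans (Sumℕ.sum-+ S _ _) (cong (_+ edges G S) (trans (Sumℕ.sum-*ʳ S (4 * K) _)
                 (cong (_* (4 * K)) (sym (length-filter-∑ (λ i → r S i ≤? 4 * K) S))))) ⟩
          length R * (4 * K) + edges G S
            ≤⟨ +-monoʳ-≤ (length R * (4 * K)) edges≤ ⟩
          length R * (4 * K) + 2 * K * suc m
            ≡⟨ cong (_+ 2 * K * suc m) (solve 2 (λ K l → l :* (con 4 :* K) := con 2 :* K :* (con 2 :* l)) refl K (length R)) ⟩
          2 * K * (2 * length R) + 2 * K * suc m ∎))
          where
          open ≤-Reasoning
          pointwise : ∀ i → 4 * K ≤ χ (does (r S i ≤? 4 * K)) * (4 * K) + r S i
          pointwise i = χ-cases (r S i ≤? 4 * K) (λ _ → ≤-refl) (λ p → <⇒≤ (≰⇒> p))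

        instance
          R≢0 : NonZero (length R)
          R≢0 = ≢-nonZero λ z → contradiction (subst (λ l → suc m ≤ 2 * l) z |S|≤2|R|) λ ()

        E₀ E : ℕ
        E₀ = ∑ℕ S (colDegree A R)
        E  = ∑ℕ C (colDegree A R)

        K|R|≤2E₀ : K * length R ≤ 2 * E₀
        K|R|≤2E₀ = begin
          K * length R            ≡⟨ trans (*-comm K (length R)) (sym (∑-const R K)) ⟩
          ∑ℕ R (λ _ → K)          ≤⟨ Sumℕ.sum-mono R (λ i∈ → K≤2r (proj₁ (∈-filter⁻ (λ i → r S i ≤? 4 * K) {xs = S} i∈))) ⟩
          ∑ℕ R (λ i → 2 * r S i)  ≡⟨ trans (Sumℕ.sum-*ˡ R 2 (r S)) (cong (2 *_) (Sumℕ.sum-comm R S _)) ⟩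
          2 * E₀                  ∎
          where open ≤-Reasoning

        -- Each column outside `C` is light and loses at most `s`.
        E₀≤ : E₀ ≤ E + s * suc m
        E₀≤ = begin
          E₀
            ≤⟨ Sumℕ.sum-mono S (λ {j} _ → pointwise j) ⟩
          ∑ℕ S (λ j → χ (does (s ≤? colDegree A R j)) * colDegree A R j + s)
            ≡⟨ trans (Sumℕ.sum-+ S _ _) (cong₂ _+_ (sym (∑-filter (λ j → s ≤? colDegree A R j) S (colDegree A R)))
                 (trans (∑-const S s) (trans (cong (_* s) |S|) (*-comm (suc m) s)))) ⟩
          E + s * suc m ∎
          where
          open ≤-Reasoning
          pointwise : ∀ j → colDegree A R j ≤ χ (does (s ≤? colDegree A R j)) * colDegree A R j + s
          pointwise j = χ-cases (s ≤? colDegree A R j) (λ _ → ≤-refl) (λ p → <⇒≤ (≰⇒> p))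

        0<s : 0 < s
        0<s = >-nonZero⁻¹ s {{m*n≢0 (2 * e) t {{m*n≢0 2 e}} {{>-nonZero 0<t}}}}

        eE≤ : e * E ≤ 2 * ((e * M + 4 * K) * (length R * g))
        eE≤ = mass e (e * M + 4 * K) {{>-nonZero (≤-trans (>-nonZero⁻¹ (4 * K) {{m*n≢0 4 K}}) (m≤n+m (4 * K) (e * M)))}} R C (λ j∈ → ≤-trans 0<s (s≤ j∈))
          λ {l} l∈ → ∑-codegree² G t 0<t K-free e (4 * K) R C l uR uC
            (λ {i} i∈ → ≤-trans (rC≤rS i) (proj₂ (∈-filter⁻ (λ i → r S i ≤? 4 * K) {xs = S} i∈))) (s≤ l∈)
          where
          s≤ : ∀ {j} → j ∈ C → s ≤ colDegree A R j
          s≤ j∈ = proj₂ (∈-filter⁻ (λ j → s ≤? colDegree A R j) {xs = S} j∈)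
          rC≤rS : ∀ i → r C i ≤ r S i
          rC≤rS i = subst (_≤ r S i) (sym (∑-filter (λ j → s ≤? colDegree A R j) S _))
            (Sumℕ.sum-mono S λ {j} _ → χ*≤ (does (s ≤? colDegree A R j)) (χ (A i j)))

        contra : K < K
        -- Since `e` is `32 * g`, the left side is twice `16 g K |R|`, and one copy cancels the
        -- `4 * K` term of the mass bound. Dividing by `16 g |R|` leaves `K ≤ 8 g M + 8 s`, which is
        -- `K` without its last summand 2.
        contra = ≤-<-trans (*-cancelˡ-≤ (16 * g) {{m*n≢0 16 g}} (*-cancelʳ-≤ _ _ (length R)
          (+-cancelʳ-≤ (16 * g * K * length R) _ _ (begin
            16 * g * K * length R + 16 * g * K * length R
              ≡⟨ solve 3 (λ g K l → con 16 :* g :* K :* l :+ con 16 :* g :* K :* l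
                   := con 32 :* g :* (K :* l)) refl g K (length R) ⟩
            e * (K * length R)
              ≤⟨ *-monoʳ-≤ e (≤-trans K|R|≤2E₀ (*-monoʳ-≤ 2 (≤-trans E₀≤ (+-monoʳ-≤ E (*-monoʳ-≤ s |S|≤2|R|))))) ⟩
            e * (2 * (E + s * (2 * length R)))
              ≡⟨ solve 4 (λ e E s l → e :* (con 2 :* (E :+ s :* (con 2 :* l)))
                   := con 2 :* (e :* E) :+ con 4 :* e :* s :* l) refl e E s (length R) ⟩
            2 * (e * E) + 4 * e * s * length R
              ≤⟨ +-monoˡ-≤ (4 * e * s * length R) (*-monoʳ-≤ 2 eE≤) ⟩
            2 * (2 * ((e * M + 4 * K) * (length R * g))) + 4 * e * s * length R
              ≡⟨ solve 5 (λ g M K s l →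
                   con 2 :* (con 2 :* ((con 32 :* g :* M :+ con 4 :* K) :* (l :* g))) :+ con 4 :* (con 32 :* g) :* s :* l
                   := con 16 :* g :* (con 8 :* (g :* M) :+ con 8 :* s) :* l :+ con 16 :* g :* K :* l)
                   refl g M K s (length R) ⟩
            16 * g * (8 * (g * M) + 8 * s) * length R + 16 * g * K * length R ∎))))
          (m<m+n (8 * (g * M) + 8 * s) (s≤s z≤n))
          where open ≤-Reasoning

open Counting using (χ; χ-idem; ∑-const; colDegree; codegree; MassBound; edges; edge-bound; sparse)

open import Data.Rational.Base
open import Data.Rational.Properties
open import Data.Rational.Solver using (module +-*-Solver)

open +-*-Solver using (solve; _:=_; _:+_; _:*_; :-_; con)

open module Sumℚ = ListSum (IsCommutativeRing.isCommutativeSemiring +-*-isCommutativeRing)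
  _≤_ ≤-refl +-mono-≤
  using () renaming (sum to ∑ℚ)

-- The spectral argument

*-nonNeg : ∀ {p q} → 0ℚ ≤ p → 0ℚ ≤ q → 0ℚ ≤ p * q
*-nonNeg {p} {q} 0≤p 0≤q =
  subst (_≤ p * q) (*-zeroʳ p) (*-monoˡ-≤-nonNeg p {{nonNegative 0≤p}} 0≤q)

*-monoˡ-≤ : ∀ {p q r} → 0ℚ ≤ r → p ≤ q → r * p ≤ r * q
*-monoˡ-≤ {r = r} 0≤r = *-monoˡ-≤-nonNeg r {{nonNegative 0≤r}}

square-nonNeg : ∀ p → 0ℚ ≤ p * p
square-nonNeg p with ≤-total 0ℚ p
... | inj₁ 0≤p = *-nonNeg 0≤p 0≤p
... | inj₂ p≤0 = subst (0ℚ ≤_) (solve 1 (λ p → :- p :* :- p := p :* p) refl p)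
  (*-nonNeg (neg-antimono-≤ p≤0) (neg-antimono-≤ p≤0))

square-mono-≤ : ∀ {p q} → 0ℚ ≤ p → p ≤ q → p * p ≤ q * q
square-mono-≤ {p} {q} 0≤p p≤q = ≤-trans (*-monoˡ-≤ 0≤p p≤q)
  (*-monoʳ-≤-nonNeg q {{nonNegative (≤-trans 0≤p p≤q)}} p≤q)

0≤q-p⇒p≤q : ∀ p q → 0ℚ ≤ q + - p → p ≤ q
0≤q-p⇒p≤q p q h = subst₂ _≤_ (+-identityˡ p)
  (solve 2 (λ p q → q :+ :- p :+ p := q) refl p q) (+-monoˡ-≤ p h)

p≤q⇒0≤q-p : ∀ {p q} → p ≤ q → 0ℚ ≤ q + - p
p≤q⇒0≤q-p {p} {q} p≤q = subst (_≤ q + - p) (+-inverseʳ p) (+-monoˡ-≤ (- p) p≤q)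

∑-nonNeg : ∀ (xs : List I) {f : I → ℚ} → (∀ {x} → x ∈ xs → 0ℚ ≤ f x) → 0ℚ ≤ ∑ℚ xs f
∑-nonNeg xs {f} 0≤f = subst (_≤ ∑ℚ xs f) (Sumℚ.sum-zero xs) (Sumℚ.sum-mono xs 0≤f)

∑-linear : ∀ (xs : List I) c (f g : I → ℚ) →
           ∑ℚ xs (λ x → f x + c * g x) ≡ ∑ℚ xs f + c * ∑ℚ xs g
∑-linear xs c f g = trans (Sumℚ.sum-+ xs f (λ x → c * g x)) (cong (∑ℚ xs f +_) (Sumℚ.sum-*ˡ xs c g))

-- 1 / p, with the value 0 for p ≤ 0.
inv : ℚ → ℚ
inv p with p ≤? 0ℚ
... | yes _   = 0ℚ
... | no  p≰0 = 1/_ p {{pos⇒nonZero p {{positive (≰⇒> p≰0)}}}}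

*-inv : ∀ {p} → 0ℚ < p → p * inv p ≡ 1ℚ
*-inv {p} 0<p with p ≤? 0ℚ
... | yes p≤0 = contradiction refl (<⇒≢ (<-≤-trans 0<p p≤0))
... | no  p≰0 = *-inverseʳ p {{pos⇒nonZero p {{positive (≰⇒> p≰0)}}}}

inv-nonNeg : ∀ p → 0ℚ ≤ inv p
inv-nonNeg p with p ≤? 0ℚ
... | yes _   = ≤-refl
... | no  p≰0 = <⇒≤ (positive⁻¹ _ {{1/pos⇒pos p {{positive (≰⇒> p≰0)}}}})

inv-pos : ∀ {p} → 0ℚ < p → 0ℚ < inv p
inv-pos {p} 0<p = ≰⇒> λ i≤0 → <⇒≢ (positive⁻¹ 1ℚ) (≤-antisym (<⇒≤ (positive⁻¹ 1ℚ)) (begin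
  1ℚ         ≡⟨ *-inv 0<p ⟨
  p * inv p  ≤⟨ *-monoˡ-≤ (<⇒≤ 0<p) i≤0 ⟩
  p * 0ℚ     ≡⟨ *-zeroʳ p ⟩
  0ℚ         ∎))
  where open ≤-Reasoning

inv≤1 : ∀ {p} → 1ℚ ≤ p → inv p ≤ 1ℚ
inv≤1 {p} 1≤p = begin
  inv p       ≡⟨ *-identityʳ (inv p) ⟨
  inv p * 1ℚ  ≤⟨ *-monoˡ-≤ (inv-nonNeg p) 1≤p ⟩
  inv p * p   ≡⟨ trans (*-comm (inv p) p) (*-inv (<-≤-trans (positive⁻¹ 1ℚ) 1≤p)) ⟩
  1ℚ          ∎
  where open ≤-Reasoning

-- Resolvents of weighted sums of rank one matrices

module _ (rows : List I) where

  ⟨_,_⟩ : (I → ℚ) → (I → ℚ) → ℚ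
  ⟨ x , y ⟩ = ∑ℚ rows λ i → x i * y i

  dot-comm : ∀ x y → ⟨ x , y ⟩ ≡ ⟨ y , x ⟩
  dot-comm x y = Sumℚ.sum-cong rows λ i → *-comm (x i) (y i)

  dot-linear : ∀ x c y z → ⟨ x , (λ i → y i + c * z i) ⟩ ≡ ⟨ x , y ⟩ + c * ⟨ x , z ⟩
  dot-linear x c y z = trans
    (Sumℚ.sum-cong rows λ i → solve 4 (λ x c y z → x :* (y :+ c :* z) := x :* y :+ c :* (x :* z))
      refl (x i) c (y i) (z i))
    (∑-linear rows c (λ i → x i * y i) (λ i → x i * z i))

  dot-∑ : ∀ (ks : List L) (c : L → ℚ) (x : L → I → ℚ) y →
          ⟨ (λ i → ∑ℚ ks λ k → c k * x k i) , y ⟩ ≡ ∑ℚ ks λ k → c k * ⟨ x k , y ⟩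
  dot-∑ ks c x y = begin
    ∑ℚ rows (λ i → ∑ℚ ks (λ k → c k * x k i) * y i)
      ≡⟨ Sumℚ.sum-cong rows (λ i → sym (Sumℚ.sum-*ʳ ks (y i) (λ k → c k * x k i))) ⟩
    ∑ℚ rows (λ i → ∑ℚ ks (λ k → c k * x k i * y i))
      ≡⟨ Sumℚ.sum-comm rows ks _ ⟩
    ∑ℚ ks (λ k → ∑ℚ rows (λ i → c k * x k i * y i))
      ≡⟨ Sumℚ.sum-cong ks (λ k → trans
           (Sumℚ.sum-cong rows (λ i → *-assoc (c k) (x k i) (y i)))
           (Sumℚ.sum-*ˡ rows (c k) (λ i → x k i * y i))) ⟩
    ∑ℚ ks (λ k → c k * ⟨ x k , y ⟩) ∎
    where open ≡-Reasoning

  norm-nonNeg : ∀ x → 0ℚ ≤ ⟨ x , x ⟩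
  norm-nonNeg x = ∑-nonNeg rows λ {i} _ → square-nonNeg (x i)

  module Resolvent (a : J → I → ℚ) (Y : J → ℚ) (0≤Y : ∀ j → 0ℚ ≤ Y j) where

    -- The operator `1 + S` with `S = ∑ Y j a_j a_jᵀ`.
    shifted : List J → (I → ℚ) → I → ℚ
    shifted C w i = w i + ∑ℚ C λ j → Y j * ⟨ a j , w ⟩ * a j i

    -- The bilinear form `⟨x , (1 + S) y⟩`, written so that its symmetry is visible.
    form : List J → (I → ℚ) → (I → ℚ) → ℚ
    form C x y = ⟨ x , y ⟩ + ∑ℚ C λ j → Y j * ⟨ a j , x ⟩ * ⟨ a j , y ⟩

    -- No inverse operator is formed, only solutions of `(1 + S) w = u`. Together with `form-sym`
    -- this pairing stands in for the self-adjointness of the inverse.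
    dot-shifted : ∀ C {w u} x → (∀ i → shifted C w i ≡ u i) → ⟨ u , x ⟩ ≡ form C w x
    dot-shifted C {w} {u} x eq = begin
      ⟨ u , x ⟩
        ≡⟨ Sumℚ.sum-cong rows (λ i → cong (_* x i) (sym (eq i))) ⟩
      ⟨ shifted C w , x ⟩
        ≡⟨ trans (Sumℚ.sum-cong rows (λ i → *-distribʳ-+ (x i) (w i) _))
             (Sumℚ.sum-+ rows (λ i → w i * x i) _) ⟩
      ⟨ w , x ⟩ + ⟨ (λ i → ∑ℚ C λ j → Y j * ⟨ a j , w ⟩ * a j i) , x ⟩
        ≡⟨ cong (⟨ w , x ⟩ +_) (dot-∑ C (λ j → Y j * ⟨ a j , w ⟩) a x) ⟩
      form C w x ∎
      where open ≡-Reasoning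

    form-sym : ∀ C x y → form C x y ≡ form C y x
    form-sym C x y = cong₂ _+_ (dot-comm x y) (Sumℚ.sum-cong C λ j →
      solve 3 (λ Y p q → Y :* p :* q := Y :* q :* p) refl (Y j) ⟨ a j , x ⟩ ⟨ a j , y ⟩)

    form-linear : ∀ C x c y z → form C x (λ i → y i + c * z i) ≡ form C x y + c * form C x z
    form-linear C x c y z = begin
      form C x (λ i → y i + c * z i)
        ≡⟨ cong₂ _+_ (dot-linear x c y z) (trans
             (Sumℚ.sum-cong C (λ j → trans (cong (Y j * ⟨ a j , x ⟩ *_) (dot-linear (a j) c y z))
               (solve 4 (λ Y c p q → Y :* (p :+ c :* q) := Y :* p :+ c :* (Y :* q)) refl
                 (Y j * ⟨ a j , x ⟩) c ⟨ a j , y ⟩ ⟨ a j , z ⟩)))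
             (∑-linear C c _ _)) ⟩
      (⟨ x , y ⟩ + c * ⟨ x , z ⟩) + (S y + c * S z)
        ≡⟨ solve 5 (λ c p q r s → (p :+ c :* q) :+ (r :+ c :* s) := (p :+ r) :+ c :* (q :+ s))
             refl c ⟨ x , y ⟩ ⟨ x , z ⟩ (S y) (S z) ⟩
      form C x y + c * form C x z ∎
      where
      open ≡-Reasoning
      S : (I → ℚ) → ℚ
      S y = ∑ℚ C λ j → Y j * ⟨ a j , x ⟩ * ⟨ a j , y ⟩

    weighted-nonNeg : ∀ C x → 0ℚ ≤ ∑ℚ C λ j → Y j * ⟨ a j , x ⟩ * ⟨ a j , x ⟩
    weighted-nonNeg C x = ∑-nonNeg C λ {j} _ → subst (0ℚ ≤_) (sym (*-assoc (Y j) _ _))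
      (*-nonNeg (0≤Y j) (square-nonNeg ⟨ a j , x ⟩))

    form-nonNeg : ∀ C x → 0ℚ ≤ form C x x
    form-nonNeg C x = +-mono-≤ (norm-nonNeg x) (weighted-nonNeg C x)

    -- The Sherman–Morrison update for the rank one summand a j.
    solvable : ∀ C u → ∃[ w ] ∀ i → shifted C w i ≡ u i
    solvable []      u = u , λ i → +-identityʳ (u i)
    solvable (j ∷ C) u = w , eq
      where
      w₀ z : I → ℚ
      w₀ = proj₁ (solvable C u)
      z  = proj₁ (solvable C (a j))
      p q t c : ℚ
      p = ⟨ a j , w₀ ⟩
      q = ⟨ a j , z ⟩
      t = 1ℚ + Y j * q
      c = - (Y j * p * inv t)
      -- `q` is the form at `z`, which makes the Sherman-Morrison denominator `t` positive.
      0≤q : 0ℚ ≤ q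
      0≤q = subst (0ℚ ≤_) (sym (dot-shifted C z (proj₂ (solvable C (a j))))) (form-nonNeg C z)
      0<t : 0ℚ < t
      0<t = +-mono-<-≤ (positive⁻¹ 1ℚ) (*-nonNeg (0≤Y j) 0≤q)
      w : I → ℚ
      w i = w₀ i + c * z i
      shifted-linear : ∀ i → shifted C w i ≡ shifted C w₀ i + c * shifted C z i
      shifted-linear i = trans
        (cong (w i +_) (trans
          (Sumℚ.sum-cong C λ l → trans (cong (λ d → Y l * d * a l i) (dot-linear (a l) c w₀ z))
            (solve 5 (λ Y a c p q → Y :* (p :+ c :* q) :* a := Y :* p :* a :+ c :* (Y :* q :* a))
              refl (Y l) (a l i) c ⟨ a l , w₀ ⟩ ⟨ a l , z ⟩))
          (∑-linear C c _ _)))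
        (solve 5 (λ c p q r s → (p :+ c :* q) :+ (r :+ c :* s) := (p :+ r) :+ c :* (q :+ s))
          refl c (w₀ i) (z i) _ _)
      eq : ∀ i → shifted (j ∷ C) w i ≡ u i
      eq i = begin
        w i + (Y j * ⟨ a j , w ⟩ * a j i + S)
          ≡⟨ solve 3 (λ w x S → w :+ (x :+ S) := (w :+ S) :+ x) refl (w i) _ S ⟩
        shifted C w i + Y j * ⟨ a j , w ⟩ * a j i
          ≡⟨ cong₂ (λ x d → x + Y j * d * a j i)
               (trans (shifted-linear i) (cong₂ (λ x y → x + c * y)
                 (proj₂ (solvable C u) i) (proj₂ (solvable C (a j)) i)))
               (dot-linear (a j) c w₀ z) ⟩
        (u i + c * a j i) + Y j * (p + c * q) * a j i
          ≡⟨ solve 6 (λ u a Y p q v →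
               (u :+ (:- (Y :* p :* v)) :* a) :+ Y :* (p :+ (:- (Y :* p :* v)) :* q) :* a
               := u :+ Y :* p :* a :+ (:- (Y :* p :* a :* ((con 1ℚ :+ Y :* q) :* v))))
               refl (u i) (a j i) (Y j) p q (inv t) ⟩
        u i + Y j * p * a j i + - (Y j * p * a j i * (t * inv t))
          ≡⟨ cong (λ e → u i + Y j * p * a j i + - (Y j * p * a j i * e)) (*-inv 0<t) ⟩
        u i + Y j * p * a j i + - (Y j * p * a j i * 1ℚ)
          ≡⟨ solve 2 (λ u x → u :+ x :+ (:- (x :* con 1ℚ)) := u) refl (u i) (Y j * p * a j i) ⟩
        u i ∎
        where
        open ≡-Reasoning
        S = ∑ℚ C λ l → Y l * ⟨ a l , w ⟩ * a l i

    -- |(1 + S) w|² ≥ 2 ⟨w , S w⟩, where S is the weighted sum of the projections.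
    resolvent-bound : ∀ C {w u} → (∀ i → shifted C w i ≡ u i) →
                      (1ℚ + 1ℚ) * ∑ℚ C (λ j → Y j * ⟨ a j , w ⟩ * ⟨ a j , w ⟩) ≤ ⟨ u , u ⟩
    resolvent-bound C {w} {u} eq = begin
      (1ℚ + 1ℚ) * S                       ≤⟨ 0≤q-p⇒p≤q _ _ (subst (0ℚ ≤_) lemma
                                               (+-mono-≤ (norm-nonNeg w) (norm-nonNeg (λ i → u i + - 1ℚ * w i)))) ⟩
      ⟨ u , u ⟩                           ∎
      where
      open ≤-Reasoning
      S = ∑ℚ C λ j → Y j * ⟨ a j , w ⟩ * ⟨ a j , w ⟩
      uw : ⟨ u , w ⟩ ≡ ⟨ w , w ⟩ + S
      uw = dot-shifted C w eq
      -- `d = S w`, so `lemma` is the expansion of `|w + S w|²`.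
      d : I → ℚ
      d i = u i + - 1ℚ * w i
      lemma : ⟨ w , w ⟩ + ⟨ d , d ⟩ ≡ ⟨ u , u ⟩ + - ((1ℚ + 1ℚ) * S)
      lemma = begin-equality
        ⟨ w , w ⟩ + ⟨ d , d ⟩
          ≡⟨ cong (⟨ w , w ⟩ +_) (trans (dot-linear d (- 1ℚ) u w)
               (cong₂ (λ x y → x + - 1ℚ * y)
                 (trans (dot-comm d u) (dot-linear u (- 1ℚ) u w))
                 (trans (dot-comm d w) (dot-linear w (- 1ℚ) u w)))) ⟩
        ⟨ w , w ⟩ + ((⟨ u , u ⟩ + - 1ℚ * ⟨ u , w ⟩) + - 1ℚ * (⟨ w , u ⟩ + - 1ℚ * ⟨ w , w ⟩))
          ≡⟨ cong₂ (λ x y → ⟨ w , w ⟩ + ((⟨ u , u ⟩ + - 1ℚ * x) + - 1ℚ * (y + - 1ℚ * ⟨ w , w ⟩)))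
               uw (trans (dot-comm w u) uw) ⟩
        _ ≡⟨ solve 3 (λ w u s → w :+ ((u :+ :- con 1ℚ :* (w :+ s)) :+ :- con 1ℚ :* ((w :+ s) :+ :- con 1ℚ :* w))
               := u :+ (:- ((con 1ℚ :+ con 1ℚ) :* s))) refl ⟨ w , w ⟩ ⟨ u , u ⟩ S ⟩
        ⟨ u , u ⟩ + - ((1ℚ + 1ℚ) * S) ∎

2ℚ ¼ : ℚ
2ℚ = 1ℚ + 1ℚ
¼ = ½ * ½

-- The mass bound for a factorized matrix

module _
  (rows : List I) (cols : List J) (ks : List L)
  (A : I → J → ℚ) (U : I → L → ℚ) (V : L → J → ℚ)
  (A≡UV : ∀ i j → A i j ≡ ∑ℚ ks λ k → V k j * U i k)
  {g κ : ℚ}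
  (U-bound : ∀ i → (∑ℚ ks λ k → U i k * U i k) ≤ g)
  (V-bound : ∀ j → (∑ℚ ks λ k → V k j * V k j) ≤ 1ℚ)
  (0<κ : 0ℚ < κ)
  where

  private
    a : J → I → ℚ
    a j i = A i j

    infix 8 _·_
    _·_ : (I → ℚ) → (I → ℚ) → ℚ
    _·_ = ⟨_,_⟩ rows

    D : J → ℚ
    D j = a j · a j

  -- Three estimates are combined: `E ≤ Θ + E / 2` from positivity of the form, `Θ ≤ E / 4 + κ X`
  -- from the factorization, and `2 X ≤ G` from the resolvent bound.
  mass-bound :
    (∀ {j} → j ∈ cols → 0ℚ < D j) →
    (∀ {l} → l ∈ cols → (∑ℚ cols λ j → (a l · a j) * (a l · a j)) ≤ κ * (D l * D l)) →
    ∑ℚ cols D ≤ 2ℚ * (κ * ∑ℚ rows λ _ → g)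
  mass-bound 0<D correlations = 0≤q-p⇒p≤q E _ (subst (0ℚ ≤_) (final E Θ κ X G)
    (+-mono-≤ (*-nonNeg {1ℚ + 1ℚ + 1ℚ + 1ℚ} (nonNegative⁻¹ _) (p≤q⇒0≤q-p Θ≤))
      (+-mono-≤ (*-nonNeg {1ℚ + 1ℚ + 1ℚ + 1ℚ} (nonNegative⁻¹ _) (p≤q⇒0≤q-p E≤))
        (*-nonNeg {2ℚ} (nonNegative⁻¹ _) (*-nonNeg (<⇒≤ 0<κ) (p≤q⇒0≤q-p 2X≤G))))))
    where
    -- This weight turns a correlation bound `κ D²` into `D` in `form≤`, and balances the two terms
    -- of the AM-GM step in `θ≤`.
    Y : J → ℚ
    Y j = inv (κ * D j)

    0≤Y : ∀ j → 0ℚ ≤ Y j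
    0≤Y j = inv-nonNeg (κ * D j)

    κDY≡1 : ∀ {j} → j ∈ cols → κ * D j * Y j ≡ 1ℚ
    κDY≡1 {j} j∈ = *-inv (subst (_< κ * D j) (*-zeroʳ κ)
      (*-monoʳ-<-pos κ {{positive 0<κ}} (0<D j∈)))

    open Resolvent rows a Y 0≤Y

    u : L → I → ℚ
    u k i = U i k

    y : J → I → ℚ
    y j = proj₁ (solvable cols (a j))

    w : L → I → ℚ
    w k = proj₁ (solvable cols (u k))

    θ : J → ℚ
    θ j = a j · y j

    E Θ X G : ℚ
    E = ∑ℚ cols D
    Θ = ∑ℚ cols θ
    X = ∑ℚ ks λ k → ∑ℚ cols λ j → Y j * (a j · w k) * (a j · w k)
    G = ∑ℚ rows λ _ → g

    -- The three estimates are added with weights `4`, `4` and `2 κ`, chosen so that `Θ` and `X`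
    -- cancel and one `E` is left.
    final : ∀ E Θ κ X G →
      (1ℚ + 1ℚ + 1ℚ + 1ℚ) * ((¼ * E + κ * X) + - Θ) +
        ((1ℚ + 1ℚ + 1ℚ + 1ℚ) * ((Θ + ¼ * (E + E)) + - E) + 2ℚ * (κ * (G + - (2ℚ * X))))
      ≡ 2ℚ * (κ * G) + - E
    final = solve 5 (λ E Θ κ X G →
      let four = con 1ℚ :+ con 1ℚ :+ con 1ℚ :+ con 1ℚ ; two = con 1ℚ :+ con 1ℚ ; ¼ = con ½ :* con ½ in
      four :* ((¼ :* E :+ κ :* X) :+ :- Θ) :+
        (four :* ((Θ :+ ¼ :* (E :+ E)) :+ :- E) :+ two :* (κ :* (G :+ :- (two :* X))))
      := two :* (κ :* G) :+ :- E) refl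

    2X≤G : 2ℚ * X ≤ G
    2X≤G = begin
      2ℚ * X
        ≡⟨ Sumℚ.sum-*ˡ ks 2ℚ _ ⟨
      ∑ℚ ks (λ k → 2ℚ * ∑ℚ cols λ j → Y j * (a j · w k) * (a j · w k))
        ≤⟨ Sumℚ.sum-mono ks (λ {k} _ → resolvent-bound cols (proj₂ (solvable cols (u k)))) ⟩
      ∑ℚ ks (λ k → u k · u k)
        ≡⟨ Sumℚ.sum-comm ks rows _ ⟩
      ∑ℚ rows (λ i → ∑ℚ ks λ k → U i k * U i k)
        ≤⟨ Sumℚ.sum-mono rows (λ {i} _ → U-bound i) ⟩
      G ∎
      where open ≤-Reasoning

    -- After exchanging the two sums, `Y l` multiplies the whole correlation sum of the column `l`,
    -- to which the hypothesis applies.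
    form≤ : ∑ℚ cols (λ j → form cols (a j) (a j)) ≤ E + E
    form≤ = begin
      ∑ℚ cols (λ j → form cols (a j) (a j))
        ≡⟨ Sumℚ.sum-+ cols D _ ⟩
      E + ∑ℚ cols (λ j → ∑ℚ cols λ l → Y l * (a l · a j) * (a l · a j))
        ≡⟨ cong (E +_) (trans (Sumℚ.sum-comm cols cols _) (Sumℚ.sum-cong cols λ l →
             trans (Sumℚ.sum-cong cols λ j → *-assoc (Y l) (a l · a j) (a l · a j))
               (Sumℚ.sum-*ˡ cols (Y l) _))) ⟩
      E + ∑ℚ cols (λ l → Y l * ∑ℚ cols λ j → (a l · a j) * (a l · a j))
        ≤⟨ +-monoʳ-≤ E (Sumℚ.sum-mono cols λ {l} l∈ → ≤-trans
             (*-monoˡ-≤ (0≤Y l) (correlations l∈))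
             (≤-reflexive (trans
               (solve 3 (λ Y κ D → Y :* (κ :* (D :* D)) := (κ :* D :* Y) :* D) refl (Y l) κ (D l))
               (trans (cong (_* D l) (κDY≡1 l∈)) (*-identityˡ (D l)))))) ⟩
      E + E ∎
      where open ≤-Reasoning

    -- Positivity of the form at y j - ½ a j.
    D≤ : ∀ j → D j ≤ θ j + ¼ * form cols (a j) (a j)
    D≤ j = 0≤q-p⇒p≤q (D j) _ (subst (0ℚ ≤_) eq (form-nonNeg cols d))
      where
      y-solves = proj₂ (solvable cols (a j))
      d : I → ℚ
      d i = y j i + - ½ * a j i
      F = form cols
      eq : F d d ≡ θ j + ¼ * F (a j) (a j) + - D j
      eq = begin
        F d d
          ≡⟨ trans (form-linear cols d (- ½) (y j) (a j)) (cong₂ (λ p q → p + - ½ * q)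
               (trans (form-sym cols d (y j)) (form-linear cols (y j) (- ½) (y j) (a j)))
               (trans (form-sym cols d (a j)) (form-linear cols (a j) (- ½) (y j) (a j)))) ⟩
        (F (y j) (y j) + - ½ * F (y j) (a j)) + - ½ * (F (a j) (y j) + - ½ * F (a j) (a j))
          ≡⟨ cong₂ (λ p q → (p + - ½ * q) + - ½ * (F (a j) (y j) + - ½ * F (a j) (a j)))
               (sym (dot-shifted cols (y j) y-solves)) (sym (dot-shifted cols (a j) y-solves)) ⟩
        (θ j + - ½ * D j) + - ½ * (F (a j) (y j) + - ½ * F (a j) (a j))
          ≡⟨ cong (λ p → (θ j + - ½ * D j) + - ½ * (p + - ½ * F (a j) (a j)))
               (trans (form-sym cols (a j) (y j)) (sym (dot-shifted cols (a j) y-solves))) ⟩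
        (θ j + - ½ * D j) + - ½ * (D j + - ½ * F (a j) (a j))
          ≡⟨ solve 3 (λ t D f → (t :+ :- con ½ :* D) :+ :- con ½ :* (D :+ :- con ½ :* f)
               := t :+ con ½ :* con ½ :* f :+ :- D) refl (θ j) (D j) (F (a j) (a j)) ⟩
        θ j + ¼ * F (a j) (a j) + - D j ∎
        where open ≡-Reasoning

    E≤ : E ≤ Θ + ¼ * (E + E)
    E≤ = begin
      E
        ≤⟨ Sumℚ.sum-mono cols (λ {j} _ → D≤ j) ⟩
      ∑ℚ cols (λ j → θ j + ¼ * form cols (a j) (a j))
        ≡⟨ ∑-linear cols ¼ θ _ ⟩
      Θ + ¼ * ∑ℚ cols (λ j → form cols (a j) (a j))
        ≤⟨ +-monoʳ-≤ Θ (*-monoˡ-≤ {r = ¼} (nonNegative⁻¹ _) form≤) ⟩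
      Θ + ¼ * (E + E) ∎
      where open ≤-Reasoning

    -- Expanding `a j` in the columns of `U` and using symmetry of the form moves the resolvent from
    -- `a j` onto `u k`.
    θ≡ : ∀ j → θ j ≡ ∑ℚ ks λ k → V k j * (a j · w k)
    θ≡ j = begin
      a j · y j
        ≡⟨ Sumℚ.sum-cong rows (λ i → cong (_* y j i) (A≡UV i j)) ⟩
      (λ i → ∑ℚ ks λ k → V k j * u k i) · y j
        ≡⟨ dot-∑ rows ks (λ k → V k j) u (y j) ⟩
      ∑ℚ ks (λ k → V k j * (u k · y j))
        ≡⟨ Sumℚ.sum-cong ks (λ k → cong (V k j *_) (trans
             (dot-shifted cols (y j) (proj₂ (solvable cols (u k)))) (trans
             (form-sym cols (w k) (y j))
             (sym (dot-shifted cols (w k) (proj₂ (solvable cols (a j)))))))) ⟩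
      ∑ℚ ks (λ k → V k j * (a j · w k)) ∎
      where open ≡-Reasoning

    -- AM-GM, using κ D Y = 1.
    θ≤ : ∀ {j} → j ∈ cols → θ j ≤ ¼ * D j + κ * ∑ℚ ks λ k → Y j * (a j · w k) * (a j · w k)
    θ≤ {j} j∈ = begin
      θ j
        ≡⟨ θ≡ j ⟩
      ∑ℚ ks (λ k → V k j * (a j · w k))
        ≤⟨ Sumℚ.sum-mono ks (λ {k} _ → step (V k j) (a j · w k)) ⟩
      ∑ℚ ks (λ k → ¼ * D j * (V k j * V k j) + κ * (Y j * (a j · w k) * (a j · w k)))
        ≡⟨ trans (∑-linear ks κ _ _) (cong (_+ κ * S) (Sumℚ.sum-*ˡ ks (¼ * D j) _)) ⟩
      ¼ * D j * ∑ℚ ks (λ k → V k j * V k j) + κ * S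
        ≤⟨ +-monoˡ-≤ (κ * S) (≤-trans (*-monoˡ-≤ 0≤¼D (V-bound j)) (≤-reflexive (*-identityʳ (¼ * D j)))) ⟩
      ¼ * D j + κ * S ∎
      where
      open ≤-Reasoning
      S = ∑ℚ ks λ k → Y j * (a j · w k) * (a j · w k)
      0≤¼D : 0ℚ ≤ ¼ * D j
      0≤¼D = *-nonNeg {¼} (nonNegative⁻¹ _) (<⇒≤ (0<D j∈))
      step : ∀ v t → v * t ≤ ¼ * D j * (v * v) + κ * (Y j * t * t)
      step v t = 0≤q-p⇒p≤q _ _ (subst (0ℚ ≤_)
        (trans (solve 5 (λ κ Y D v t →
            κ :* Y :* ((con ½ :* D :* v :+ :- t) :* (con ½ :* D :* v :+ :- t))
            := (κ :* D :* Y) :* (con ½ :* con ½ :* D :* (v :* v) :+ :- (v :* t)) :+ κ :* (Y :* t :* t))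
            refl κ (Y j) (D j) v t)
          (trans (cong (λ e → e * (¼ * D j * (v * v) + - (v * t)) + κ * (Y j * t * t)) (κDY≡1 j∈))
            (solve 3 (λ p q r → con 1ℚ :* (p :+ :- q) :+ r := p :+ r :+ :- q) refl
              (¼ * D j * (v * v)) (v * t) (κ * (Y j * t * t)))))
        (*-nonNeg (*-nonNeg (<⇒≤ 0<κ) (0≤Y j)) (square-nonNeg (½ * D j * v + - t))))

    Θ≤ : Θ ≤ ¼ * E + κ * X
    Θ≤ = begin
      Θ
        ≤⟨ Sumℚ.sum-mono cols θ≤ ⟩
      ∑ℚ cols (λ j → ¼ * D j + κ * ∑ℚ ks λ k → Y j * (a j · w k) * (a j · w k))
        ≡⟨ trans (∑-linear cols κ _ _) (cong₂ (λ p q → p + κ * q)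
             (Sumℚ.sum-*ˡ cols ¼ D) (Sumℚ.sum-comm cols ks _)) ⟩
      ¼ * E + κ * X ∎
      where open ≤-Reasoning

-- From real to exact rational factorizations

-- Built by `mkℚ`, so that `ι 0` and `ι 1` compute to `0ℚ` and `1ℚ`.
ι : ℕ → ℚ
ι n = mkℚ (ℤ.+ n) 0 (coprime-sym (1-coprimeTo n))

ι-+ : ∀ m n → ι (m ℕ.+ n) ≡ ι m + ι n
ι-+ m n = toℚᵘ-injective (ℚᵘₚ.≃-trans
  (ℚᵘ.*≡* (cong (ℤ._* ℤ.+ 1) (sym (cong₂ ℤ._+_ (ℤₚ.*-identityʳ (ℤ.+ m)) (ℤₚ.*-identityʳ (ℤ.+ n))))))
  (ℚᵘₚ.≃-sym (toℚᵘ-homo-+ (ι m) (ι n))))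

ι-* : ∀ m n → ι (m ℕ.* n) ≡ ι m * ι n
ι-* m n = toℚᵘ-injective (ℚᵘₚ.≃-trans
  (ℚᵘ.*≡* (cong (ℤ._* ℤ.+ 1) (ℤₚ.pos-* m n)))
  (ℚᵘₚ.≃-sym (toℚᵘ-homo-* (ι m) (ι n))))

ι-mono-≤ : ∀ {m n} → m ℕ.≤ n → ι m ≤ ι n
ι-mono-≤ m≤n = *≤* (ℤₚ.*-monoʳ-≤-nonNeg (ℤ.+ 1) (ℤ.+≤+ m≤n))

ι-cancel-≤ : ∀ {m n} → ι m ≤ ι n → m ℕ.≤ n
ι-cancel-≤ {m} {n} (*≤* h) = ℤₚ.drop‿+≤+ (subst₂ ℤ._≤_ (ℤₚ.*-identityʳ (ℤ.+ m)) (ℤₚ.*-identityʳ (ℤ.+ n)) h)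

ι-mono-< : ∀ {m n} → m ℕ.< n → ι m < ι n
ι-mono-< m<n = ≰⇒> λ h → ℕₚ.<⇒≱ m<n (ι-cancel-≤ h)

ι-nonNeg : ∀ n → 0ℚ ≤ ι n
ι-nonNeg n = ι-mono-≤ ℕ.z≤n

ι-∑ : ∀ (xs : List I) f → ι (∑ℕ xs f) ≡ ∑ℚ xs λ x → ι (f x)
ι-∑ []       f = refl
ι-∑ (x ∷ xs) f = trans (ι-+ (f x) (∑ℕ xs f)) (cong (ι (f x) +_) (ι-∑ xs f))

archimedean : ∀ p → ∃[ n ] p ≤ ι n
archimedean p@(mkℚ n d _) = ℤ.∣ n ∣ , *≤* (ℤₚ.≤-trans (≤∣∣ n) (ℤₚ.*-monoˡ-≤-nonNeg (ℤ.+ ℤ.∣ n ∣) (ℤ.+≤+ (ℕ.s≤s ℕ.z≤n))))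
  where
  ≤∣∣ : ∀ n → n ℤ.* ℤ.+ 1 ℤ.≤ ℤ.+ ℤ.∣ n ∣ ℤ.* ℤ.+ 1
  ≤∣∣ (ℤ.+ n)    = ℤₚ.≤-refl
  ≤∣∣ ℤ.-[1+ n ] = ℤ.-≤+

-- The whole cost is moved into `U`, and norms are squared to stay within the rationals. An
-- arbitrary `Index` type allows the disjoint sum in `approximate⇒exact`.
record ExactFactorization (A : I → J → ℚ) (g : ℚ) : Set₁ where
  field
    {Index} : Set
    indices : List Index
    U       : I → Index → ℚ
    V       : Index → J → ℚ
    A≡UV    : ∀ i j → A i j ≡ ∑ℚ indices λ k → V k j * U i k
    U-bound : ∀ i → (∑ℚ indices λ k → U i k * U i k) ≤ g
    V-bound : ∀ j → (∑ℚ indices λ k → V k j * V k j) ≤ 1ℚ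

module _ {n} (G : Graph n) where

  ι-adj : Fin n → Fin n → ℚ
  ι-adj i j = ι (χ (adj G i j))

  -- This is `mass-bound` with `κ = L / e`. For a 0/1 matrix the inner products of columns are
  -- codegrees, and idempotence of `χ` turns squared norms into degrees.
  exact⇒massBound : ∀ {g} → ExactFactorization ι-adj (ι g) → MassBound G g
  exact⇒massBound {g} F e L rows cols 0<D codegrees = ι-cancel-≤ (begin
    ι (e ℕ.* E)
      ≡⟨ trans (ι-* e E) (cong (ι e *_) (trans (ι-∑ cols _) (Sumℚ.sum-cong cols λ j → sym (norm j)))) ⟩
    ι e * ∑ℚ cols (λ j → ⟨_,_⟩ rows (a j) (a j))
      ≤⟨ *-monoˡ-≤ (ι-nonNeg e) (mass-bound rows cols indices ι-adj U V A≡UV U-bound V-bound 0<κ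
           (λ {j} j∈ → subst (0ℚ <_) (sym (norm j)) (ι-mono-< (0<D j∈))) correlations) ⟩
    ι e * (2ℚ * (κ * ∑ℚ rows λ _ → ι g))
      ≡⟨ solve 5 (λ e e⁻¹ L two s → e :* (two :* ((L :* e⁻¹) :* s)) := (e :* e⁻¹) :* (two :* (L :* s)))
           refl (ι e) (inv (ι e)) (ι L) 2ℚ (∑ℚ rows λ _ → ι g) ⟩
    (ι e * inv (ι e)) * (2ℚ * (ι L * ∑ℚ rows λ _ → ι g))
      ≡⟨ cong₂ (λ x y → x * (2ℚ * (ι L * y))) (*-inv 0<e)
           (trans (sym (ι-∑ rows (λ _ → g))) (cong ι (∑-const rows g))) ⟩
    1ℚ * (2ℚ * (ι L * ι (length rows ℕ.* g)))
      ≡⟨ *-identityˡ _ ⟩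
    2ℚ * (ι L * ι (length rows ℕ.* g))
      ≡⟨ trans (cong (2ℚ *_) (sym (ι-* L (length rows ℕ.* g)))) (sym (ι-* 2 (L ℕ.* (length rows ℕ.* g)))) ⟩
    ι (2 ℕ.* (L ℕ.* (length rows ℕ.* g))) ∎)
    where
    open ≤-Reasoning
    open ExactFactorization F
    a : Fin n → Fin n → ℚ
    a j i = ι-adj i j
    E : ℕ
    E = ∑ℕ cols (colDegree (adj G) rows)
    D : Fin n → ℕ
    D = colDegree (adj G) rows
    κ : ℚ
    κ = ι L * inv (ι e)

    0<e : 0ℚ < ι e
    0<e = ι-mono-< (ℕ.>-nonZero⁻¹ e)

    0<κ : 0ℚ < κ
    0<κ = ≰⇒> λ κ≤0 → <⇒≢ (ι-mono-< (ℕ.>-nonZero⁻¹ L)) (≤-antisym (ι-nonNeg L) (begin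
      ι L                      ≡⟨ *-identityʳ (ι L) ⟨
      ι L * 1ℚ                 ≡⟨ cong (ι L *_) (*-inv 0<e) ⟨
      ι L * (ι e * inv (ι e))  ≡⟨ solve 3 (λ L e e⁻¹ → L :* (e :* e⁻¹) := e :* (L :* e⁻¹)) refl (ι L) (ι e) (inv (ι e)) ⟩
      ι e * κ                  ≤⟨ *-monoˡ-≤ (ι-nonNeg e) κ≤0 ⟩
      ι e * 0ℚ                 ≡⟨ *-zeroʳ (ι e) ⟩
      0ℚ                       ∎))

    dot : ∀ l j → ⟨_,_⟩ rows (a l) (a j) ≡ ι (codegree G rows l j)
    dot l j = trans (Sumℚ.sum-cong rows λ i → sym (ι-* (χ (adj G i l)) (χ (adj G i j)))) (sym (ι-∑ rows _))

    norm : ∀ j → ⟨_,_⟩ rows (a j) (a j) ≡ ι (D j)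
    norm j = trans (dot j j) (cong ι (Sumℕ.sum-cong rows λ i → χ-idem (adj G i j)))

    correlations : ∀ {l} → l ∈ cols → (∑ℚ cols λ j → ⟨_,_⟩ rows (a l) (a j) * ⟨_,_⟩ rows (a l) (a j)) ≤
                   κ * (⟨_,_⟩ rows (a l) (a l) * ⟨_,_⟩ rows (a l) (a l))
    correlations {l} l∈ = begin
      ∑ℚ cols (λ j → ⟨_,_⟩ rows (a l) (a j) * ⟨_,_⟩ rows (a l) (a j))
        ≡⟨ trans (Sumℚ.sum-cong cols λ j → trans (cong₂ _*_ (dot l j) (dot l j)) (sym (ι-* (c j) (c j)))) (sym (ι-∑ cols _)) ⟩
      ι S
        ≡⟨ trans (sym (*-identityˡ (ι S))) (cong (_* ι S) (trans (sym (*-inv 0<e)) (*-comm (ι e) (inv (ι e))))) ⟩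
      inv (ι e) * ι e * ι S
        ≡⟨ trans (*-assoc (inv (ι e)) (ι e) (ι S)) (cong (inv (ι e) *_) (sym (ι-* e S))) ⟩
      inv (ι e) * ι (e ℕ.* S)
        ≤⟨ *-monoˡ-≤ (inv-nonNeg (ι e)) (ι-mono-≤ (codegrees l∈)) ⟩
      inv (ι e) * ι (L ℕ.* (D l ℕ.* D l))
        ≡⟨ cong (inv (ι e) *_) (trans (ι-* L _) (cong (ι L *_) (trans (ι-* (D l) (D l)) (cong₂ _*_ (sym (norm l)) (sym (norm l)))))) ⟩
      inv (ι e) * (ι L * (N * N))
        ≡⟨ solve 3 (λ x y z → x :* (y :* z) := (y :* x) :* z) refl (inv (ι e)) (ι L) (N * N) ⟩
      κ * (N * N) ∎
      where
      c = codegree G rows l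
      S = ∑ℕ cols λ j → c j ℕ.* c j
      N = ⟨_,_⟩ rows (a l) (a l)

-- Absorbing the error of an approximate factorization

kronecker : ∀ {n} → Fin n → Fin n → ℚ
kronecker i j = ι (χ (does (i Finₚ.≟ j)))

∑-allFin-suc : ∀ n (f : Fin (suc n) → ℚ) → ∑ℚ (allFin (suc n)) f ≡ f zero + ∑ℚ (allFin n) λ i → f (suc i)
∑-allFin-suc n f = cong (f zero +_) (trans (cong (λ xs → ∑ℚ xs f) (sym (map-tabulate id suc))) (Sumℚ.sum-map suc (allFin n) f))

∑-kronecker : ∀ {n} (i : Fin n) (f : Fin n → ℚ) → (∑ℚ (allFin n) λ l → kronecker i l * f l) ≡ f i
∑-kronecker {suc n} zero    f = begin
  ∑ℚ (allFin (suc n)) (λ l → kronecker zero l * f l)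
    ≡⟨ ∑-allFin-suc n (λ l → kronecker zero l * f l) ⟩
  1ℚ * f zero + ∑ℚ (allFin n) (λ l → 0ℚ * f (suc l))
    ≡⟨ cong₂ _+_ (*-identityˡ (f zero)) (trans (Sumℚ.sum-*ˡ (allFin n) 0ℚ (λ l → f (suc l))) (*-zeroˡ (∑ℚ (allFin n) λ l → f (suc l)))) ⟩
  f zero + 0ℚ
    ≡⟨ +-identityʳ (f zero) ⟩
  f zero ∎
  where open ≡-Reasoning
∑-kronecker {suc n} (suc i) f = begin
  ∑ℚ (allFin (suc n)) (λ l → kronecker (suc i) l * f l)
    ≡⟨ ∑-allFin-suc n (λ l → kronecker (suc i) l * f l) ⟩
  0ℚ * f zero + ∑ℚ (allFin n) (λ l → kronecker i l * f (suc l))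
    ≡⟨ cong₂ _+_ (*-zeroˡ (f zero)) (∑-kronecker i (λ l → f (suc l))) ⟩
  0ℚ + f (suc i)
    ≡⟨ +-identityˡ (f (suc i)) ⟩
  f (suc i) ∎
  where open ≡-Reasoning

kronecker-diag : ∀ {n} (i : Fin n) → kronecker i i ≡ 1ℚ
kronecker-diag zero    = refl
kronecker-diag (suc i) = kronecker-diag i

-- The error A - uv is absorbed by bordering u with the identity and v with the error.
approximate⇒exact : ∀ {n k} (A : Fin n → Fin n → ℚ) (u : Fin n → Fin k → ℚ) (v : Fin k → Fin n → ℚ) {p q c} →
  0ℚ ≤ p → 0ℚ < q → p * q ≤ c →
  (∀ i → (∑ℚ (allFin k) λ l → u i l * u i l) ≤ p * p) →
  (∀ j → (∑ℚ (allFin k) λ l → v l j * v l j) ≤ q * q) →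
  (let err i j = A i j + - ∑ℚ (allFin k) (λ l → u i l * v l j)) →
  (∀ j → (∑ℚ (allFin n) λ i → err i j * err i j) ≤ 1ℚ) →
  ExactFactorization A (ι 4 * (c * c) + ι 4)
approximate⇒exact {n} {k} A u v {p} {q} {c} 0≤p 0<q pq≤c u≤ v≤ err≤ = record
  { indices = map inj₁ (allFin k) ++ map inj₂ (allFin n)
  ; U = U ; V = V ; A≡UV = A≡UV ; U-bound = U-bound ; V-bound = V-bound }
  where
  err : Fin n → Fin n → ℚ
  err i j = A i j + - ∑ℚ (allFin k) (λ l → u i l * v l j)

  -- Scaling `v` by `1 / (2 q)` and the error by `½` gives each block of `V` squared norm at most
  -- `¼`. The inverse factors `2 q` and `2` on the side of `U` produce `4 (p q)² + 4`.
  U : Fin n → Fin k ⊎ Fin n → ℚ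
  U i = [ (λ l → ι 2 * q * u i l) , (λ l → ι 2 * kronecker i l) ]′
  V : Fin k ⊎ Fin n → Fin n → ℚ
  V l j = [ (λ l → ½ * inv q * v l j) , (λ l → ½ * err l j) ]′ l

  ∑-⊎ : ∀ f → ∑ℚ (map inj₁ (allFin k) ++ map inj₂ (allFin n)) f ≡
              ∑ℚ (allFin k) (λ l → f (inj₁ l)) + ∑ℚ (allFin n) (λ l → f (inj₂ l))
  ∑-⊎ f = trans (Sumℚ.sum-++ (map inj₁ (allFin k)) (map inj₂ (allFin n)) f)
    (cong₂ _+_ (Sumℚ.sum-map inj₁ (allFin k) f) (Sumℚ.sum-map inj₂ (allFin n) f))

  A≡UV : ∀ i j → _
  A≡UV i j = sym (begin
    _ ≡⟨ ∑-⊎ (λ l → V l j * U i l) ⟩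
    ∑ℚ (allFin k) (λ l → ½ * inv q * v l j * (ι 2 * q * u i l)) +
    ∑ℚ (allFin n) (λ l → ½ * err l j * (ι 2 * kronecker i l))
      ≡⟨ cong₂ _+_
           (trans (Sumℚ.sum-cong (allFin k) λ l → trans
               (solve 4 (λ q r v u → con ½ :* r :* v :* (con (ι 2) :* q :* u) := (q :* r) :* (u :* v))
                 refl q (inv q) (v l j) (u i l))
               (trans (cong (_* (u i l * v l j)) (*-inv 0<q)) (*-identityˡ _)))
             refl)
           (trans (Sumℚ.sum-cong (allFin n) λ l →
               solve 2 (λ e d → con ½ :* e :* (con (ι 2) :* d) := d :* e) refl (err l j) (kronecker i l))
             (∑-kronecker i (λ l → err l j))) ⟩
    S + (A i j + - S)
      ≡⟨ solve 2 (λ s a → s :+ (a :+ :- s) := a) refl S (A i j) ⟩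
    A i j ∎)
    where
    open ≡-Reasoning
    S = ∑ℚ (allFin k) (λ l → u i l * v l j)

  U-bound : ∀ i → _
  U-bound i = begin
    _ ≡⟨ ∑-⊎ (λ l → U i l * U i l) ⟩
    ∑ℚ (allFin k) (λ l → ι 2 * q * u i l * (ι 2 * q * u i l)) +
    ∑ℚ (allFin n) (λ l → ι 2 * kronecker i l * (ι 2 * kronecker i l))
      ≡⟨ cong₂ _+_
           (trans (Sumℚ.sum-cong (allFin k) λ l →
               solve 2 (λ q u → con (ι 2) :* q :* u :* (con (ι 2) :* q :* u) := con (ι 4) :* (q :* q) :* (u :* u)) refl q (u i l))
             (Sumℚ.sum-*ˡ (allFin k) (ι 4 * (q * q)) _))
           (trans (Sumℚ.sum-cong (allFin n) λ l →
               solve 1 (λ d → con (ι 2) :* d :* (con (ι 2) :* d) := d :* (con (ι 4) :* d)) refl (kronecker i l))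
             (trans (∑-kronecker i (λ l → ι 4 * kronecker i l)) (cong (ι 4 *_) (kronecker-diag i)))) ⟩
    ι 4 * (q * q) * ∑ℚ (allFin k) (λ l → u i l * u i l) + ι 4 * 1ℚ
      ≤⟨ +-monoˡ-≤ (ι 4 * 1ℚ) (*-monoˡ-≤ (*-nonNeg {ι 4} (nonNegative⁻¹ _) (square-nonNeg q)) (u≤ i)) ⟩
    ι 4 * (q * q) * (p * p) + ι 4
      ≡⟨ cong (_+ ι 4) (solve 2 (λ p q → con (ι 4) :* (q :* q) :* (p :* p) := con (ι 4) :* ((p :* q) :* (p :* q))) refl p q) ⟩
    ι 4 * ((p * q) * (p * q)) + ι 4
      ≤⟨ +-monoˡ-≤ (ι 4) (*-monoˡ-≤ {r = ι 4} (nonNegative⁻¹ _) (square-mono-≤ (*-nonNeg 0≤p (<⇒≤ 0<q)) pq≤c)) ⟩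
    ι 4 * (c * c) + ι 4 ∎
    where open ≤-Reasoning

  V-bound : ∀ j → _
  V-bound j = begin
    _ ≡⟨ ∑-⊎ (λ l → V l j * V l j) ⟩
    ∑ℚ (allFin k) (λ l → ½ * inv q * v l j * (½ * inv q * v l j)) +
    ∑ℚ (allFin n) (λ l → ½ * err l j * (½ * err l j))
      ≡⟨ cong₂ _+_
           (trans (Sumℚ.sum-cong (allFin k) λ l →
               solve 2 (λ r v → con ½ :* r :* v :* (con ½ :* r :* v) := con ¼ :* (r :* r) :* (v :* v)) refl (inv q) (v l j))
             (Sumℚ.sum-*ˡ (allFin k) (¼ * (inv q * inv q)) _))
           (trans (Sumℚ.sum-cong (allFin n) λ l →
               solve 1 (λ e → con ½ :* e :* (con ½ :* e) := con ¼ :* (e :* e)) refl (err l j))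
             (Sumℚ.sum-*ˡ (allFin n) ¼ _)) ⟩
    ¼ * (inv q * inv q) * ∑ℚ (allFin k) (λ l → v l j * v l j) + ¼ * ∑ℚ (allFin n) (λ l → err l j * err l j)
      ≤⟨ +-mono-≤ (*-monoˡ-≤ (*-nonNeg {¼} (nonNegative⁻¹ _) (square-nonNeg (inv q))) (v≤ j))
           (*-monoˡ-≤ {r = ¼} (nonNegative⁻¹ _) (err≤ j)) ⟩
    ¼ * (inv q * inv q) * (q * q) + ¼ * 1ℚ
      ≡⟨ cong (_+ ¼ * 1ℚ) (trans (solve 2 (λ q r → con ¼ :* (r :* r) :* (q :* q) := con ¼ :* ((q :* r) :* (q :* r))) refl q (inv q))
           (cong (λ x → ¼ * (x * x)) (*-inv 0<q))) ⟩
    ¼ * (1ℚ * 1ℚ) + ¼ * 1ℚ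
      ≤⟨ *≤* (ℤ.+≤+ (ℕ.s≤s ℕ.z≤n)) ⟩
    1ℚ ∎
    where open ≤-Reasoning

-- Evaluating a real factorization at a late index

p≤∣p∣ : ∀ p → p ≤ ∣ p ∣
p≤∣p∣ p with ≤-total 0ℚ p
... | inj₁ 0≤p = ≤-reflexive (sym (0≤p⇒∣p∣≡p 0≤p))
... | inj₂ p≤0 = ≤-trans p≤0 (0≤∣p∣ p)

∣p-q∣<ε⇒p≤q+ε : ∀ p q {ε} → ∣ p - q ∣ < ε → p ≤ q + ε
∣p-q∣<ε⇒p≤q+ε p q {ε} h = begin
  p            ≡⟨ solve 2 (λ p q → p := q :+ (p :+ :- q)) refl p q ⟩
  q + (p - q)  ≤⟨ +-monoʳ-≤ q (≤-trans (p≤∣p∣ (p - q)) (<⇒≤ h)) ⟩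
  q + ε        ∎
  where open ≤-Reasoning

∣p-q∣-sym : ∀ p q → ∣ p - q ∣ ≡ ∣ q - p ∣
∣p-q∣-sym p q = trans (sym (∣-p∣≡∣p∣ (p - q)))
  (cong ∣_∣ (solve 2 (λ p q → :- (p :+ :- q) := q :+ :- p) refl p q))

∣p∣≤q≤1⇒p²≤q : ∀ p {q} → ∣ p ∣ ≤ q → q ≤ 1ℚ → p * p ≤ q
∣p∣≤q≤1⇒p²≤q p {q} ∣p∣≤q q≤1 = begin
  p * p          ≡⟨ 0≤p⇒∣p∣≡p (square-nonNeg p) ⟨
  ∣ p * p ∣      ≡⟨ ∣p*q∣≡∣p∣*∣q∣ p p ⟩
  ∣ p ∣ * ∣ p ∣  ≤⟨ square-mono-≤ (0≤∣p∣ p) ∣p∣≤q ⟩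
  q * q          ≤⟨ *-monoˡ-≤ (≤-trans (0≤∣p∣ p) ∣p∣≤q) q≤1 ⟩
  q * 1ℚ         ≡⟨ *-identityʳ q ⟩
  q              ∎
  where open ≤-Reasoning

infixr 4 _∧_

_∧_ : ∀ {P Q : ℕ → Set} → Eventually P → Eventually Q → Eventually λ n → P n × Q n
(M , p) ∧ (N , q) = M ℕ.⊔ N , λ n h →
  p n (ℕₚ.≤-trans (ℕₚ.m≤m⊔n M N) h) , q n (ℕₚ.≤-trans (ℕₚ.m≤n⊔m M N) h)

map-eventually : ∀ {P Q : ℕ → Set} → (∀ {n} → P n → Q n) → Eventually P → Eventually Q
map-eventually f (N , p) = N , λ n h → f (p n h)

∀-eventually : ∀ {m} {P : Fin m → ℕ → Set} → (∀ i → Eventually (P i)) → Eventually λ n → ∀ i → P i n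
∀-eventually {zero}  p = 0 , λ _ _ ()
∀-eventually {suc m} p = map-eventually (λ { (p₀ , ps) zero → p₀ ; (p₀ , ps) (suc i) → ps i })
  (p zero ∧ ∀-eventually (λ i → p (suc i)))

bounded : ∀ x → ∃[ B ] Eventually λ n → seq x n ≤ ι B
bounded x with cauchy x 1ℚ (positive⁻¹ 1ℚ)
... | N , close with archimedean (seq x N + 1ℚ)
... | B , ≤B = B , N , λ n N≤n →
  ≤-trans (∣p-q∣<ε⇒p≤q+ε (seq x n) (seq x N) (close n N N≤n ℕₚ.≤-refl)) ≤B

seq-∑ : ∀ {n} (v : Vector ℝ n) N → seq (∑ v) N ≡ ∑ℚ (allFin n) λ i → seq (v i) N
seq-∑ {zero}  v N = refl
seq-∑ {suc n} v N = trans (cong (seq (v zero) N +_) (seq-∑ (λ i → v (suc i)) N)) (sym (∑-allFin-suc n (λ i → seq (v i) N)))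

max⁺-nonNeg : ∀ {n} (v : Vector ℝ n) N → 0ℚ ≤ seq (max⁺ v) N
max⁺-nonNeg {zero}  v N = ≤-refl
max⁺-nonNeg {suc n} v N = ≤-trans (max⁺-nonNeg (λ i → v (suc i)) N) (p≤q⊔p (seq (v zero) N) _)

≤-max⁺ : ∀ {n} (v : Vector ℝ n) N i → seq (v i) N ≤ seq (max⁺ v) N
≤-max⁺ v N zero    = p≤p⊔q (seq (v zero) N) _
≤-max⁺ v N (suc i) = ≤-trans (≤-max⁺ (λ i → v (suc i)) N i) (p≤q⊔p (seq (v zero) N) _)

½^-nonNeg : ∀ n → 0ℚ ≤ ½^ n
½^-nonNeg zero    = nonNegative⁻¹ 1ℚ
½^-nonNeg (suc n) = *-nonNeg {½} (nonNegative⁻¹ ½) (½^-nonNeg n)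

bisect-nonNeg : ∀ {q} → 0ℚ ≤ q → ∀ n → 0ℚ ≤ bisect q n
bisect-nonNeg 0≤q zero = ≤-refl
bisect-nonNeg {q} 0≤q (suc n) = if-nonNeg (does (mid * mid ≤? q))
  where
  mid = bisect q n + ½^ suc n * (1ℚ + q)
  if-nonNeg : ∀ b → 0ℚ ≤ (if b then mid else bisect q n)
  if-nonNeg true  = +-mono-≤ (bisect-nonNeg 0≤q n)
    (*-nonNeg (½^-nonNeg (suc n)) (+-mono-≤ (nonNegative⁻¹ 1ℚ) 0≤q))
  if-nonNeg false = bisect-nonNeg 0≤q n

-- At a fixed index `√` is only an approximate root, hence the slack `ε` from `√-square`. The
-- comparison of a row norm with the maximum is exact at every index.
rows-bounded : ∀ {m k} (U : Matrix m k) ε → 0ℚ < ε → Eventually λ N → ∀ i →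
  (∑ℚ (allFin k) λ l → seq (U i l) N * seq (U i l) N) ≤ seq ‖ U ‖row N * seq ‖ U ‖row N + ε
rows-bounded {k = k} U ε 0<ε = ∀-eventually λ i →
  let x = ∑ λ l → U i l *ℝ U i l
      seq-x : ∀ N → seq x N ≡ ∑ℚ (allFin k) λ l → seq (U i l) N * seq (U i l) N
      seq-x = seq-∑ (λ l → U i l *ℝ U i l)
      0≤x : ∀ N → 0ℚ ≤ seq x N
      0≤x N = subst (0ℚ ≤_) (sym (seq-x N)) (∑-nonNeg (allFin k) λ {l} _ → square-nonNeg (seq (U i l) N))
      M , close = √-square x (λ ε 0<ε → 0 , λ N _ → +-mono-≤-< (0≤x N) 0<ε) ε 0<ε
  in M , λ N M≤N → ≤-trans (≤-reflexive (sym (seq-x N))) (≤-trans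
       (∣p-q∣<ε⇒p≤q+ε (seq x N) _ (subst (_< ε) (∣p-q∣-sym (seq (√ x) N * seq (√ x) N) (seq x N)) (close N M≤N)))
       (+-monoˡ-≤ ε (square-mono-≤ (bisect-nonNeg (p≤q⊔p (seq x N) 0ℚ) N) (≤-max⁺ (λ i → ‖ U i ‖₂) N i))))

seq-adjacency : ∀ b N → seq (if b then 1ℝ else 0ℝ) N ≡ ι (χ b)
seq-adjacency true  N = refl
seq-adjacency false N = refl

-- Finitely many limit statements about the attaining factorization hold at one common index `N`.
-- Its terms there form a rational approximate factorization of cost at most `B + 3`, to which
-- `approximate⇒exact` applies.
γ₂-AtMost⇒exact : ∀ {n} (G : Graph n) γ B → (Eventually λ N → seq γ N ≤ ι B) → γ₂-AtMost γ G →
                  ExactFactorization (ι-adj G) (ι (4 ℕ.* ((B ℕ.+ 3) ℕ.* (B ℕ.+ 3)) ℕ.+ 4))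
γ₂-AtMost⇒exact {n} G γ B γ≤B (g , γ₂≃g , g≤γ) =
  let N , late = proj₂ (bounded ‖ U ‖row) ∧ proj₂ (bounded ‖ V ‖col) ∧ γ≤B ∧ g≤γ 1ℚ (positive⁻¹ 1ℚ) ∧
        proj₂ attained 1ℚ (positive⁻¹ 1ℚ) ∧
        rows-bounded U (δ * δ) 0<δ² ∧ rows-bounded (transpose V) (δ * δ) 0<δ² ∧
        ∀-eventually λ i → ∀-eventually λ j → U⊗V≋M i j η 0<η
      p≤P , q≤Q , γ≤ , g≤ , cost≈ , u≤ , v≤ , UV≈ = late N ℕₚ.≤-refl
  in Stage.exact N p≤P q≤Q γ≤ g≤ cost≈ u≤ v≤ UV≈
  where
  open γ₂[_]≃_ γ₂≃g
  F = proj₁ attained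
  open Factorization F using (U; V; U⊗V≋M)

  P Q : ℕ
  P = proj₁ (bounded ‖ U ‖row)
  Q = proj₁ (bounded ‖ V ‖col)

  -- Adding `δ` to both norms absorbs the slack `δ * δ` of `rows-bounded` and makes the second one
  -- positive; its size gives `δ * (p + q + δ) ≤ 1`. With entrywise error below `η`, the `n` squared
  -- errors of a column sum to at most 1.
  δ η : ℚ
  δ = inv (ι P + ι Q + 1ℚ)
  η = inv (ι (suc n))

  1≤ : 1ℚ ≤ ι P + ι Q + 1ℚ
  1≤ = +-mono-≤ (+-mono-≤ (ι-nonNeg P) (ι-nonNeg Q)) ≤-refl

  0<δ : 0ℚ < δ
  0<δ = inv-pos (<-≤-trans (positive⁻¹ 1ℚ) 1≤)

  0<η : 0ℚ < η
  0<η = inv-pos (ι-mono-< {0} {suc n} ℕ.z<s)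

  0<δ² : 0ℚ < δ * δ
  0<δ² = subst (_< δ * δ) (*-zeroʳ δ) (*-monoʳ-<-pos δ {{positive 0<δ}} 0<δ)

  p≤p+δ : ∀ p → p ≤ p + δ
  p≤p+δ p = subst (_≤ p + δ) (+-identityʳ p) (+-monoʳ-≤ p (<⇒≤ 0<δ))

  square-+ : ∀ {p} → 0ℚ ≤ p → p * p + δ * δ ≤ (p + δ) * (p + δ)
  square-+ {p} 0≤p = 0≤q-p⇒p≤q _ _ (subst (0ℚ ≤_)
    (solve 2 (λ p d → con (ι 2) :* (p :* d) := (p :+ d) :* (p :+ d) :+ :- (p :* p :+ d :* d)) refl p δ)
    (*-nonNeg {ι 2} (nonNegative⁻¹ _) (*-nonNeg 0≤p (<⇒≤ 0<δ))))

  -- Each approximation costs 1: `g` against `γ`, the cost against `g`, and the enlargement of the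
  -- norms by `δ`.
  C : ℕ
  C = B ℕ.+ 3

  bound≡ : ι 4 * (ι C * ι C) + ι 4 ≡ ι (4 ℕ.* (C ℕ.* C) ℕ.+ 4)
  bound≡ = sym (trans (ι-+ (4 ℕ.* (C ℕ.* C)) 4) (cong (_+ ι 4) (trans (ι-* 4 (C ℕ.* C)) (cong (ι 4 *_) (ι-* C C)))))

  module Stage (N : ℕ)
    (p≤P : seq ‖ U ‖row N ≤ ι P) (q≤Q : seq ‖ V ‖col N ≤ ι Q) (γ≤ : seq γ N ≤ ι B) (g≤ : seq g N < seq γ N + 1ℚ)
    (cost≈ : ∣ seq (cost F) N - seq g N ∣ < 1ℚ)
    (u≤ : ∀ i → (∑ℚ (allFin _) λ l → seq (U i l) N * seq (U i l) N) ≤ seq ‖ U ‖row N * seq ‖ U ‖row N + δ * δ)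
    (v≤ : ∀ j → (∑ℚ (allFin _) λ l → seq (V l j) N * seq (V l j) N) ≤ seq ‖ V ‖col N * seq ‖ V ‖col N + δ * δ)
    (UV≈ : ∀ i j → ∣ seq ((U ⊗ V) i j) N - seq (adjacencyMatrix G i j) N ∣ < η)
    where

    p q : ℚ
    p = seq ‖ U ‖row N
    q = seq ‖ V ‖col N

    0≤p : 0ℚ ≤ p
    0≤p = max⁺-nonNeg (λ i → ‖ U i ‖₂) N

    0≤q : 0ℚ ≤ q
    0≤q = max⁺-nonNeg (λ j → ‖ transpose V j ‖₂) N

    pq≤ : (p + δ) * (q + δ) ≤ ι C
    pq≤ = begin
      (p + δ) * (q + δ)
        ≡⟨ solve 3 (λ p q d → (p :+ d) :* (q :+ d) := p :* q :+ d :* (p :+ q :+ d)) refl p q δ ⟩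
      p * q + δ * (p + q + δ)
        ≤⟨ +-mono-≤ (≤-trans (∣p-q∣<ε⇒p≤q+ε (p * q) (seq g N) cost≈)
               (+-monoˡ-≤ 1ℚ (≤-trans (<⇒≤ g≤) (+-monoˡ-≤ 1ℚ γ≤))))
             (*-monoˡ-≤ (<⇒≤ 0<δ) (+-mono-≤ (+-mono-≤ p≤P q≤Q) (inv≤1 1≤))) ⟩
      (ι B + 1ℚ + 1ℚ) + δ * (ι P + ι Q + 1ℚ)
        ≡⟨ cong (ι B + 1ℚ + 1ℚ +_) (trans (*-comm δ (ι P + ι Q + 1ℚ)) (*-inv (<-≤-trans (positive⁻¹ 1ℚ) 1≤))) ⟩
      (ι B + 1ℚ + 1ℚ) + 1ℚ
        ≡⟨ solve 1 (λ b → b :+ con 1ℚ :+ con 1ℚ :+ con 1ℚ := b :+ con (ι 3)) refl (ι B) ⟩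
      ι B + ι 3
        ≡⟨ ι-+ B 3 ⟨
      ι C ∎
      where open ≤-Reasoning

    err : Fin n → Fin n → ℚ
    err i j = ι-adj G i j + - ∑ℚ (allFin _) (λ l → seq (U i l) N * seq (V l j) N)

    -- Since `η ≤ 1`, squaring keeps the error below `η`; the factor `1ℚ` lets `sum-*ˡ` pull `η` out
    -- of the sum.
    err²≤ : ∀ i j → err i j * err i j ≤ η * 1ℚ
    err²≤ i j = ≤-trans (∣p∣≤q≤1⇒p²≤q (err i j) (<⇒≤ (subst (_< η)
      (trans (∣p-q∣-sym (seq ((U ⊗ V) i j) N) _)
        (cong₂ (λ a b → ∣ a - b ∣) (seq-adjacency (adj G i j) N) (seq-∑ (λ l → U i l *ℝ V l j) N)))
      (UV≈ i j))) (inv≤1 (ι-mono-≤ {1} {suc n} (ℕ.s≤s ℕ.z≤n)))) (≤-reflexive (sym (*-identityʳ η)))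

    err≤ : ∀ j → (∑ℚ (allFin n) λ i → err i j * err i j) ≤ 1ℚ
    err≤ j = begin
      ∑ℚ (allFin n) (λ i → err i j * err i j)
        ≤⟨ Sumℚ.sum-mono (allFin n) (λ {i} _ → err²≤ i j) ⟩
      ∑ℚ (allFin n) (λ _ → η * 1ℚ)
        ≡⟨ trans (Sumℚ.sum-*ˡ (allFin n) η (λ _ → 1ℚ)) (cong (η *_) ∑1) ⟩
      η * ι n
        ≤⟨ *-monoˡ-≤ (<⇒≤ 0<η) (ι-mono-≤ (ℕₚ.n≤1+n n)) ⟩
      η * ι (suc n)
        ≡⟨ trans (*-comm η (ι (suc n))) (*-inv (ι-mono-< {0} {suc n} ℕ.z<s)) ⟩
      1ℚ ∎
      where
      open ≤-Reasoning
      ∑1 : ∑ℚ (allFin n) (λ _ → 1ℚ) ≡ ι n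
      ∑1 = trans (sym (ι-∑ (allFin n) (λ _ → 1))) (cong ι (trans (∑-const (allFin n) 1)
        (trans (ℕₚ.*-identityʳ (length (allFin n))) (length-tabulate {n = n} id))))

    exact : ExactFactorization (ι-adj G) (ι (4 ℕ.* (C ℕ.* C) ℕ.+ 4))
    exact = subst (ExactFactorization (ι-adj G)) bound≡
      (approximate⇒exact (ι-adj G) (λ i l → seq (U i l) N) (λ l j → seq (V l j) N)
        (≤-trans 0≤p (p≤p+δ p)) (+-mono-≤-< 0≤q 0<δ) pq≤
        (λ i → ≤-trans (u≤ i) (square-+ 0≤p)) (λ j → ≤-trans (v≤ j) (square-+ 0≤q))
        err≤)

-- Average degree and the conclusion

∑ℕ-tabulate : ∀ {I : Set} n (h : Fin n → I) (f : I → ℕ) →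
             ∑ℕ (tabulate h) f ≡ foldr ℕ._+_ 0 (λ i → f (h i))
∑ℕ-tabulate zero    h f = refl
∑ℕ-tabulate (suc n) h f = cong (f (h zero) ℕ.+_) (∑ℕ-tabulate n (λ i → h (suc i)) f)

card-tabulate : ∀ {n} (f : Fin n → Bool) → card (Vec.tabulate f) ≡ foldr ℕ._+_ 0 (λ i → χ (f i))
card-tabulate {zero}  f = refl
card-tabulate {suc n} f with f zero
... | true  = cong suc (card-tabulate (λ i → f (suc i)))
... | false = card-tabulate (λ i → f (suc i))

∑-degree : ∀ {n} (G : Graph n) → foldr ℕ._+_ 0 (degree G) ≡ edges G (allFin n)
∑-degree {n} G = trans (sym (∑ℕ-tabulate n id (degree G))) (Sumℕ.sum-cong (allFin n) λ v →
  trans (card-tabulate (adj G v)) (sym (∑ℕ-tabulate n id (λ u → χ (adj G v u)))))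

averageDegree≤ : ∀ {n} (G : Graph n) K → edges G (allFin n) ℕ.≤ K ℕ.* n → averageDegree G ≤ ι K
averageDegree≤ {zero}  G K _ = ι-nonNeg K
averageDegree≤ {suc n} G K h = toℚᵘ-cancel-≤ (ℚᵘₚ.≤-respˡ-≃
  (ℚᵘₚ.≃-sym (toℚᵘ-fromℚᵘ (ℚᵘ.mkℚᵘ (ℤ.+ foldr ℕ._+_ 0 (degree G)) n)))
  (ℚᵘ.*≤* (subst₂ ℤ._≤_ (sym (ℤₚ.*-identityʳ _)) (ℤₚ.pos-* K (suc n))
    (ℤ.+≤+ (subst (ℕ._≤ K ℕ.* suc n) (sym (∑-degree G)) h)))))

fromℚ-mono-≤ : ∀ {p q} → p ≤ q → fromℚ p ≤ℝ fromℚ q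
fromℚ-mono-≤ {p} {q} p≤q ε 0<ε = 0 , λ _ _ →
  subst (_< q + ε) (+-identityʳ p) (+-mono-≤-< p≤q 0<ε)

theorem1p6 : (γ : ℝ) → 0ℝ <ℝ γ → DegreeBounded (γ₂-AtMost γ)
theorem1p6 γ _ t 0<t = fromℚ (ι K) , λ {n} G γ₂≤γ K-free →
  fromℚ-mono-≤ (averageDegree≤ G K (sparse g t 0<t G K-free
    (exact⇒massBound G (γ₂-AtMost⇒exact G γ B (proj₂ (bounded γ)) γ₂≤γ))
    n (allFin n) (length-tabulate id) (Unique.allFin⁺ n)))
  where
  -- `B` bounds the late terms of `γ`, and `g` is the squared row bound of the exact factorization,
  -- so `K` depends only on `γ` and `t`.
  B g K : ℕ
  B = proj₁ (bounded γ)
  g = 4 ℕ.* ((B ℕ.+ 3) ℕ.* (B ℕ.+ 3)) ℕ.+ 4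
  instance
    g≢0 : ℕ.NonZero g
    g≢0 = ℕ.>-nonZero (ℕₚ.≤-trans (ℕ.s≤s ℕ.z≤n) (ℕₚ.m≤n+m 4 (4 ℕ.* ((B ℕ.+ 3) ℕ.* (B ℕ.+ 3)))))
  K = edge-bound g t
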